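{- Let $F_1$ be the $3$-graph on vertex set $\{a,b,c,d,e,f,g\}$ with edge set $\{abe, ace, bce, abf, adf, bdf, cdg\}$. Then $\gamma^+(F_1) = \frac{2}{5}$.
   Context: For a $3$-graph $H$, the minimum positive co-degree $\delta_2^+(H)$ is the largest $k$ such that every pair of vertices contained in some edge of $H$ is contained in at least $k$ edges (it is $0$ for the edgeless graph). For a $3$-graph $F$, $\mathrm{co^+ex}(n,F)$ is the maximum of $\delta_2^+(H)$ over $n$-vertex $3$-graphs $H$ not containing $F$ as a (not necessarily induced) subhypergraph, and $\gamma^+(F)=\lim_{n\to\infty}\mathrm{co^+ex}(n,F)/n$ (the limit exists). -}

module Defs where

open import Data.Nat using (ℕ; zero; suc; _≤_; _<_; NonZero)
open import Data.Fin using (Fin; #_)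
open import Data.List using (List; []; _∷_; map; allFin)
open import Data.Nat.ListAction using (sum)

open import Data.List.Relation.Unary.All using (All)
open import Data.Bool using (Bool; true; false; if_then_else_)
open import Data.Product using (Σ; _×_; _,_; ∃)
open import Data.Sum using (_⊎_)
open import Relation.Binary.PropositionalEquality using (_≡_; _≢_)
open import Relation.Nullary using (¬_)
open import Function.Definitions using (Injective)

record 3Graph (n : ℕ) : Set where
  field
    edge     : Fin n → Fin n → Fin n → Bool
    sym₁₂    : ∀ x y z → edge x y z ≡ edge y x z
    sym₂₃    : ∀ x y z → edge x y z ≡ edge x z y
    distinct : ∀ x y z → edge x y z ≡ true → (x ≢ y) × (y ≢ z) × (x ≢ z)
open 3Graph public

codeg : ∀ {n} → 3Graph n → Fin n → Fin n → ℕ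
codeg {n} H x y = sum (map (λ z → if edge H x y z then 1 else 0) (allFin n))

InSomeEdge : ∀ {n} → 3Graph n → Fin n → Fin n → Set
InSomeEdge H x y = 1 ≤ codeg H x y

-- δ₂⁺(H) ≡ k : the largest k such that every pair contained in some edge
-- lies in at least k edges; 0 for the edgeless graph.
-- Relational form: every such pair has co-degree ≥ k, and k is attained
-- (or H has no edges and k = 0).
MinPosCodeg : ∀ {n} → 3Graph n → ℕ → Set
MinPosCodeg {n} H k =
  (∀ x y → InSomeEdge H x y → k ≤ codeg H x y) ×
  ((Σ (Fin n) λ x → Σ (Fin n) λ y → InSomeEdge H x y × codeg H x y ≡ k)
   ⊎ ((∀ (x y z : Fin n) → edge H x y z ≡ false) × k ≡ 0))

record Small3Graph : Set where
  field
    size  : ℕ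
    edges : List (Fin size × Fin size × Fin size)
open Small3Graph public

Contains : ∀ {n} → 3Graph n → Small3Graph → Set
Contains {n} H F =
  Σ (Fin (size F) → Fin n) λ φ → Injective _≡_ _≡_ φ ×
    All (λ { (a , b , c) → edge H (φ a) (φ b) (φ c) ≡ true }) (edges F)

FFree : ∀ {n} → Small3Graph → 3Graph n → Set
FFree F H = ¬ Contains H F

IsCoPlusEx : ℕ → Small3Graph → ℕ → Set
IsCoPlusEx n F m =
  (Σ (3Graph n) λ H → FFree F H × MinPosCodeg H m) ×
  (∀ (H : 3Graph n) → FFree F H → ∀ k → MinPosCodeg H k → k ≤ m)

F₁ : Small3Graph
F₁ = record
  { size  = 7
  ; edges = (# 0 , # 1 , # 4) ∷ (# 0 , # 2 , # 4) ∷ (# 1 , # 2 , # 4) ∷ (# 0 , # 1 , # 5)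
          ∷ (# 0 , # 3 , # 5) ∷ (# 1 , # 3 , # 5) ∷ (# 2 , # 3 , # 6) ∷ []
  }

-- Upper bound. Let every pair that lies in an edge have co-degree at least (2/5 + ε) n. Weight the pairs
-- covered by a pattern P and sum the weighted degrees of new vertices: for a positive proportion of
-- the vertices z, the link of z on P has more than 2/5 of the total weight. So if P has positive
-- density in H, then so has one of the patterns P + z that arise from such heavy links. Starting
-- from an edge this forces K₄⁻, and from K₄⁻ either an image of F₁ with fibres of size at most two,
-- or one of two five-vertex patterns (a star over K₄, or K₄⁻ with a vertex whose link contains a path).
-- Suitable weights on these two leave only images of F₁, and a dense image of F₁ yields F₁ itself by
-- doubling the vertices one at a time, with Cauchy–Schwarz.
--
-- Lower bound. Take classes of sizes t, t, t and n − 3t ≥ 2t with t = ⌊n/5⌋, and as edges the triples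
-- with vertices in two different small classes and the large one. Positive co-degrees are at least 2t.
-- In a copy of F₁ the vertices e and f would lie in the large class, and {a, b, c} and {a, b, d} would
-- both meet the three small classes, so that c and d would lie in the same one, contrary to the edge cdg.
module Submission where

open import Defs
open import Data.Bool using (Bool; true; false; _∧_; _∨_; not; T; if_then_else_)
open import Data.Bool.Properties using (∧-conicalˡ; ∧-conicalʳ)
import Data.Bool.Properties as 𝔹
open import Data.Empty using (⊥)
open import Data.Fin using (Fin; zero; suc; #_)
import Data.Fin as 𝔽
import Data.Fin.Properties as 𝔽
open import Data.Fin.Properties using () renaming (_≟_ to _≟ᶠ_)
open import Data.Integer using (+_)
import Data.Integer as ℤ
import Data.Integer.Properties as ℤ
open import Data.List using (List; []; _∷_; _++_; map; concatMap; length; allFin; tabulate)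
open import Data.List.Properties using (length-tabulate; map-tabulate; tabulate-cong)
open import Data.List.Relation.Unary.All using (All; []; _∷_)
import Data.List.Relation.Unary.All as All
import Data.List.Relation.Unary.All.Properties as All
open import Data.Nat using (ℕ; zero; suc; _+_; _*_; _^_; _≤_; z≤n; s≤s; NonZero)
import Data.Nat as ℕ
import Data.Nat.Properties as ℕ
import Data.Nat.DivMod as ℕ
open import Data.Nat.ListAction using (sum)
open import Data.Nat.Tactic.RingSolver using (solve-∀)
open import Data.Product using (Σ; _×_; _,_; proj₁; proj₂)
open import Data.Rational using (ℚ; _/_; _-_; ∣_∣; _<_; Positive)
import Data.Rational as ℚ
import Data.Rational.Properties as ℚ
import Data.Rational.Unnormalised as ℚᵘ
import Data.Rational.Unnormalised.Properties as ℚᵘ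
open import Data.Sum using (_⊎_; inj₁; inj₂)
open import Data.Unit using (tt)
import Data.Vec as Vec
open import Data.Vec.Properties using (lookup∘tabulate)
open import Data.List.Membership.Propositional using (_∈_)
open import Data.List.Membership.Propositional.Properties using (∈-allFin)
open import Data.List.Relation.Unary.Any using (here; there)
open import Data.Vec using (Vec; []; _∷_; lookup)
open import Function using (_∘_; id)
open import Function.Definitions using (Injective)
open import Relation.Binary.PropositionalEquality using (_≡_; _≢_; refl; sym; trans; cong; cong₂; subst; module ≡-Reasoning)
open import Relation.Nullary using (¬_; Dec; yes; no; contradiction)
open import Relation.Nullary.Decidable using (⌊_⌋; ¬?; _×-dec_; _→-dec_; _⊎-dec_; from-yes; map′)

-- Sums over lists and tuples

∑ : {A : Set} → List A → (A → ℕ) → ℕ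
∑ xs f = sum (map f xs)

module _ {A : Set} where

  ∑-mono : (xs : List A) {f g : A → ℕ} → (∀ x → f x ≤ g x) → ∑ xs f ≤ ∑ xs g
  ∑-mono []       h = z≤n
  ∑-mono (x ∷ xs) h = ℕ.+-mono-≤ (h x) (∑-mono xs h)

  ∑-cong : (xs : List A) {f g : A → ℕ} → (∀ x → f x ≡ g x) → ∑ xs f ≡ ∑ xs g
  ∑-cong []       h = refl
  ∑-cong (x ∷ xs) h = cong₂ _+_ (h x) (∑-cong xs h)

  ∑-+ : (xs : List A) (f g : A → ℕ) → ∑ xs (λ x → f x + g x) ≡ ∑ xs f + ∑ xs g
  ∑-+ []       f g = refl
  ∑-+ (x ∷ xs) f g rewrite ∑-+ xs f g = lemma (f x) (g x) _ _
    where
    lemma : ∀ a b c d → a + b + (c + d) ≡ a + c + (b + d)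
    lemma = solve-∀

  ∑-*ˡ : (xs : List A) (c : ℕ) (f : A → ℕ) → ∑ xs (λ x → c * f x) ≡ c * ∑ xs f
  ∑-*ˡ []       c f = sym (ℕ.*-zeroʳ c)
  ∑-*ˡ (x ∷ xs) c f rewrite ∑-*ˡ xs c f = sym (ℕ.*-distribˡ-+ c (f x) _)

  ∑-*ʳ : (xs : List A) (f : A → ℕ) (c : ℕ) → ∑ xs (λ x → f x * c) ≡ ∑ xs f * c
  ∑-*ʳ []       f c = refl
  ∑-*ʳ (x ∷ xs) f c rewrite ∑-*ʳ xs f c = sym (ℕ.*-distribʳ-+ c (f x) _)

  ∑-const : (xs : List A) (c : ℕ) → ∑ xs (λ _ → c) ≡ length xs * c
  ∑-const []       c = refl
  ∑-const (x ∷ xs) c = cong (λ s → c + s) (∑-const xs c)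

  ∑-++ : (xs ys : List A) (f : A → ℕ) → ∑ (xs ++ ys) f ≡ ∑ xs f + ∑ ys f
  ∑-++ []       ys f = refl
  ∑-++ (x ∷ xs) ys f rewrite ∑-++ xs ys f = sym (ℕ.+-assoc (f x) _ _)

  ∑-map : {B : Set} (h : B → A) (xs : List B) (f : A → ℕ) → ∑ (map h xs) f ≡ ∑ xs (f ∘ h)
  ∑-map h []       f = refl
  ∑-map h (x ∷ xs) f = cong (λ s → f (h x) + s) (∑-map h xs f)

  ∑-concatMap : {B : Set} (h : B → List A) (xs : List B) (f : A → ℕ) →
    ∑ (concatMap h xs) f ≡ ∑ xs (λ x → ∑ (h x) f)
  ∑-concatMap h []       f = refl
  ∑-concatMap h (x ∷ xs) f =
    trans (∑-++ (h x) _ f) (cong (λ s → ∑ (h x) f + s) (∑-concatMap h xs f))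

∑-swap : {A B : Set} (xs : List A) (ys : List B) (f : A → B → ℕ) →
  ∑ xs (λ x → ∑ ys (f x)) ≡ ∑ ys (λ y → ∑ xs (λ x → f x y))
∑-swap []       ys f = sym (trans (∑-const ys 0) (ℕ.*-zeroʳ (length ys)))
∑-swap (x ∷ xs) ys f rewrite ∑-swap xs ys f = sym (∑-+ ys (f x) _)

2xy≤x²+y² : ∀ x y → 2 * (x * y) ≤ x * x + y * y
2xy≤x²+y² x y with ℕ.≤-total x y
... | inj₁ x≤y = subst (λ y → 2 * (x * y) ≤ x * x + y * y) (ℕ.m+[n∸m]≡n x≤y)
                   (ℕ.≤-trans (ℕ.m≤m+n _ _) (ℕ.≤-reflexive (sym (lemma x (y ℕ.∸ x)))))
  where
  lemma : ∀ x d → x * x + (x + d) * (x + d) ≡ 2 * (x * (x + d)) + d * d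
  lemma = solve-∀
... | inj₂ y≤x = subst (λ x → 2 * (x * y) ≤ x * x + y * y) (ℕ.m+[n∸m]≡n y≤x)
                   (ℕ.≤-trans (ℕ.m≤m+n _ _) (ℕ.≤-reflexive (sym (lemma y (x ℕ.∸ y)))))
  where
  lemma : ∀ y d → (y + d) * (y + d) + y * y ≡ 2 * ((y + d) * y) + d * d
  lemma = solve-∀

-- Induction on the list: the cross term `2 * a * s` is split over the entries of the tail and each
-- piece is bounded by `2xy≤x²+y²`.
cauchy-schwarz : {A : Set} (xs : List A) (f : A → ℕ) →
  ∑ xs f * ∑ xs f ≤ length xs * ∑ xs (λ x → f x * f x)
cauchy-schwarz []       f = z≤n
cauchy-schwarz (x ∷ xs) f = begin
  (a + s) * (a + s)                      ≡⟨ expand a s ⟩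
  a * a + (2 * a * s + s * s)            ≤⟨ ℕ.+-monoʳ-≤ (a * a) (ℕ.+-mono-≤ cross (cauchy-schwarz xs f)) ⟩
  a * a + (ℓ * (a * a) + q + ℓ * q)      ≡⟨ collect a ℓ q ⟩
  suc ℓ * (a * a + q)                    ∎
  where
  open ℕ.≤-Reasoning
  a s q ℓ : ℕ
  a = f x
  s = ∑ xs f
  q = ∑ xs (λ y → f y * f y)
  ℓ = length xs
  expand : ∀ a s → (a + s) * (a + s) ≡ a * a + (2 * a * s + s * s)
  expand = solve-∀
  collect : ∀ a ℓ q → a * a + (ℓ * (a * a) + q + ℓ * q) ≡ suc ℓ * (a * a + q)
  collect = solve-∀
  cross : 2 * a * s ≤ ℓ * (a * a) + q
  cross = begin
    2 * a * s                           ≡⟨ ∑-*ˡ xs (2 * a) f ⟨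
    ∑ xs (λ y → 2 * a * f y)            ≤⟨ ∑-mono xs (λ y → ℕ.≤-trans (ℕ.≤-reflexive (ℕ.*-assoc 2 a (f y))) (2xy≤x²+y² a (f y))) ⟩
    ∑ xs (λ y → a * a + f y * f y)      ≡⟨ ∑-+ xs _ _ ⟩
    ∑ xs (λ _ → a * a) + q              ≡⟨ cong (_+ q) (∑-const xs (a * a)) ⟩
    ℓ * (a * a) + q                     ∎

⟦_⟧ : Bool → ℕ
⟦ b ⟧ = if b then 1 else 0

⟦⟧≤1 : ∀ b → ⟦ b ⟧ ≤ 1
⟦⟧≤1 false = z≤n
⟦⟧≤1 true  = s≤s z≤n

⟦∨⟧ : ∀ a b → ⟦ a ∨ b ⟧ ≤ ⟦ a ⟧ + ⟦ b ⟧
⟦∨⟧ false b = ℕ.≤-refl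
⟦∨⟧ true  b = s≤s z≤n

⟦∧⟧ : ∀ a b → ⟦ a ∧ b ⟧ ≡ ⟦ a ⟧ * ⟦ b ⟧
⟦∧⟧ false b = refl
⟦∧⟧ true  b = sym (ℕ.+-identityʳ _)

vecs : ∀ n k → List (Vec (Fin n) k)
vecs n zero    = [] ∷ []
vecs n (suc k) = concatMap (λ x → map (x ∷_) (vecs n k)) (allFin n)

length-allFin : ∀ n → length (allFin n) ≡ n
length-allFin n = length-tabulate id

∑-vecs : ∀ n k (f : Vec (Fin n) (suc k) → ℕ) →
  ∑ (vecs n (suc k)) f ≡ ∑ (allFin n) (λ x → ∑ (vecs n k) (λ v → f (x ∷ v)))
∑-vecs n k f = trans (∑-concatMap _ (allFin n) f)
                     (∑-cong (allFin n) (λ x → ∑-map (x ∷_) (vecs n k) f))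

length≡∑1 : {A : Set} (xs : List A) → length xs ≡ ∑ xs (λ _ → 1)
length≡∑1 xs = sym (trans (∑-const xs 1) (ℕ.*-identityʳ _))

length-vecs : ∀ n k → length (vecs n k) ≡ n ^ k
length-vecs n zero    = refl
length-vecs n (suc k) = begin
  length (vecs n (suc k))                             ≡⟨ length≡∑1 (vecs n (suc k)) ⟩
  ∑ (vecs n (suc k)) (λ _ → 1)                        ≡⟨ ∑-vecs n k (λ _ → 1) ⟩
  ∑ (allFin n) (λ _ → ∑ (vecs n k) (λ _ → 1))         ≡⟨ ∑-const (allFin n) _ ⟩
  length (allFin n) * ∑ (vecs n k) (λ _ → 1)          ≡⟨ cong₂ _*_ (length-allFin n) (trans (sym (length≡∑1 (vecs n k))) (length-vecs n k)) ⟩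
  n * n ^ k                                           ∎
  where open ≡-Reasoning

∑⟦⟧≤length : {A : Set} (xs : List A) (f : A → Bool) → ∑ xs (λ x → ⟦ f x ⟧) ≤ length xs
∑⟦⟧≤length xs f = ℕ.≤-trans (∑-mono xs (λ x → ⟦⟧≤1 (f x))) (ℕ.≤-reflexive (sym (length≡∑1 xs)))

∑-δ : ∀ {n} (y : Fin n) → ∑ (allFin n) (λ x → ⟦ ⌊ x ≟ᶠ y ⌋ ⟧) ≡ 1
∑-δ {suc n} zero = cong suc (trans (cong sum (lemma n)) (trans (∑-const (allFin n) 0) (ℕ.*-zeroʳ (length (allFin n)))))
  where
  lemma : ∀ n → map (λ x → ⟦ ⌊ x ≟ᶠ zero ⌋ ⟧) (tabulate {n = n} suc) ≡ map (λ _ → 0) (allFin n)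
  lemma n = trans (map-tabulate suc _) (sym (map-tabulate id _))
∑-δ {suc n} (suc y) = trans (cong sum lemma) (∑-δ y)
  where
  step : ∀ x → ⟦ ⌊ suc x ≟ᶠ suc y ⌋ ⟧ ≡ ⟦ ⌊ x ≟ᶠ y ⌋ ⟧
  step x with x ≟ᶠ y
  ... | yes _ = refl
  ... | no  _ = refl
  lemma : map (λ x → ⟦ ⌊ x ≟ᶠ suc y ⌋ ⟧) (tabulate {n = n} suc) ≡ map (λ x → ⟦ ⌊ x ≟ᶠ y ⌋ ⟧) (allFin n)
  lemma = trans (map-tabulate suc _)
         (trans (tabulate-cong step) (sym (map-tabulate id _)))

-- Blow-ups in dense families of tuples

-- A proportion of at least `1/C` of all tuples, with the denominator cleared so that all counting
-- stays in ℕ.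
Dense : ∀ n k → ℕ → (Vec (Fin n) k → Bool) → Set
Dense n k C f = n ^ k ≤ C * ∑ (vecs n k) (λ v → ⟦ f v ⟧)

-- The complete `k`-partite `k`-graph with two vertices in each part: the conjunction grows as
-- coordinates are peeled off, and in the end it runs over all `2 ^ k` choices.
Box : ∀ {n} k → (Vec (Fin n) k → Bool) → Set
Box         zero    f = f [] ≡ true
Box {n} (suc k) f = Σ (Fin n) λ x → Σ (Fin n) λ y →
  x ≢ y × Box k (λ v → f (x ∷ v) ∧ f (y ∷ v))

-- Doubling one coordinate replaces `C` by `2 * (C * C)` and requires `n` to exceed that number. The
-- requirements are added up, so that each follows from the sum.
boxThreshold : ℕ → ℕ → ℕ
boxThreshold zero    C = 0
boxThreshold (suc k) C = suc (2 * (C * C)) + boxThreshold k (2 * (C * C))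

-- If no pair x ≢ y had a dense common link, then the sum over v of the squared degree
-- would be smaller than Cauchy–Schwarz allows.
dense⇒denseLinks : ∀ n k C (f : Vec (Fin n) (suc k) → Bool) → 2 * (C * C) ℕ.< n →
  Dense n (suc k) C f → Σ (Fin n) λ x → Σ (Fin n) λ y →
  x ≢ y × Dense n k (2 * (C * C)) (λ v → f (x ∷ v) ∧ f (y ∷ v))
dense⇒denseLinks n k C f E<n dense
  with 𝔽.any? (λ x → 𝔽.any? (λ y → ¬? (x ≟ᶠ y) ×-dec
         (n ^ k ℕ.≤? 2 * (C * C) * ∑ (vecs n k) (λ v → ⟦ f (x ∷ v) ∧ f (y ∷ v) ⟧))))
... | yes found = found
... | no  none  = contradiction E<n (ℕ.≤⇒≯ n≤E)
  where
  open ℕ.≤-Reasoning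
  V : List (Vec (Fin n) k)
  V = vecs n k
  U : List (Fin n)
  U = allFin n
  E M S : ℕ
  E = 2 * (C * C)
  M = n ^ k
  S = ∑ V (λ v → ∑ U (λ x → ⟦ f (x ∷ v) ⟧))
  G δ : Fin n → Fin n → ℕ
  G x y = ∑ V (λ v → ⟦ f (x ∷ v) ∧ f (y ∷ v) ⟧)
  δ x y = ⟦ ⌊ y ≟ᶠ x ⌋ ⟧

  nM≤CS : n * M ≤ C * S
  nM≤CS = ℕ.≤-trans dense (ℕ.≤-reflexive (cong (C *_)
            (trans (∑-vecs n k _) (∑-swap U V _))))

  squares : ∑ V (λ v → ∑ U (λ x → ⟦ f (x ∷ v) ⟧) * ∑ U (λ x → ⟦ f (x ∷ v) ⟧))
            ≡ ∑ U (λ x → ∑ U (G x))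
  squares = begin-equality
    ∑ V (λ v → ∑ U (λ x → ⟦ f (x ∷ v) ⟧) * ∑ U (λ y → ⟦ f (y ∷ v) ⟧))
      ≡⟨ ∑-cong V (λ v → sym (∑-*ʳ U _ _)) ⟩
    ∑ V (λ v → ∑ U (λ x → ⟦ f (x ∷ v) ⟧ * ∑ U (λ y → ⟦ f (y ∷ v) ⟧)))
      ≡⟨ ∑-cong V (λ v → ∑-cong U (λ x → sym (∑-*ˡ U ⟦ f (x ∷ v) ⟧ _))) ⟩
    ∑ V (λ v → ∑ U (λ x → ∑ U (λ y → ⟦ f (x ∷ v) ⟧ * ⟦ f (y ∷ v) ⟧)))
      ≡⟨ ∑-cong V (λ v → ∑-cong U (λ x → ∑-cong U (λ y → sym (⟦∧⟧ (f (x ∷ v)) (f (y ∷ v)))))) ⟩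
    ∑ V (λ v → ∑ U (λ x → ∑ U (λ y → ⟦ f (x ∷ v) ∧ f (y ∷ v) ⟧)))
      ≡⟨ ∑-swap V U _ ⟩
    ∑ U (λ x → ∑ V (λ v → ∑ U (λ y → ⟦ f (x ∷ v) ∧ f (y ∷ v) ⟧)))
      ≡⟨ ∑-cong U (λ x → ∑-swap V U _) ⟩
    ∑ U (λ x → ∑ U (G x)) ∎

  -- Off the diagonal this is the assumption that no common link is dense. On the diagonal only
  -- `G x x ≤ M` is available, and `δ` pays for it once in each row.
  G-bound : ∀ x y → E * G x y ≤ M + δ x y * (E * M)
  G-bound x y with y ≟ᶠ x
  ... | yes _  = ℕ.≤-trans
        (ℕ.*-monoʳ-≤ E (ℕ.≤-trans (∑⟦⟧≤length V _) (ℕ.≤-reflexive (length-vecs n k))))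
        (ℕ.≤-trans (ℕ.≤-reflexive (sym (ℕ.+-identityʳ _))) (ℕ.m≤n+m _ M))
  ... | no y≢x with M ℕ.≤? E * G x y
  ...   | yes M≤ = contradiction (x , y , (λ x≡y → y≢x (sym x≡y)) , M≤) none
  ...   | no  M≰ = ℕ.≤-trans (ℕ.<⇒≤ (ℕ.≰⇒> M≰)) (ℕ.≤-reflexive (sym (ℕ.+-identityʳ M)))

  row : ∀ x → E * ∑ U (G x) ≤ n * M + E * M
  row x = begin
    E * ∑ U (G x)                              ≡⟨ ∑-*ˡ U E (G x) ⟨
    ∑ U (λ y → E * G x y)                      ≤⟨ ∑-mono U (G-bound x) ⟩
    ∑ U (λ y → M + δ x y * (E * M))            ≡⟨ ∑-+ U _ _ ⟩
    ∑ U (λ _ → M) + ∑ U (λ y → δ x y * (E * M))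
      ≡⟨ cong₂ _+_ (∑-const U M) (∑-*ʳ U (δ x) (E * M)) ⟩
    length U * M + ∑ U (δ x) * (E * M)
      ≡⟨ cong₂ _+_ (cong (_* M) (length-allFin n)) (trans (cong (_* (E * M)) (∑-δ x)) (ℕ.+-identityʳ _)) ⟩
    n * M + E * M ∎

  total : E * ∑ U (λ x → ∑ U (G x)) ≤ n * (n * M + E * M)
  total = begin
    E * ∑ U (λ x → ∑ U (G x))         ≡⟨ ∑-*ˡ U E _ ⟨
    ∑ U (λ x → E * ∑ U (G x))         ≤⟨ ∑-mono U row ⟩
    ∑ U (λ _ → n * M + E * M)         ≡⟨ ∑-const U _ ⟩
    length U * (n * M + E * M)        ≡⟨ cong (_* (n * M + E * M)) (length-allFin n) ⟩
    n * (n * M + E * M)               ∎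

  collect : 2 * (n * M * (n * M)) ≤ n * M * (n * M) + n * M * M * E
  collect = begin
    2 * (n * M * (n * M))                 ≤⟨ ℕ.*-monoʳ-≤ 2 (ℕ.*-mono-≤ nM≤CS nM≤CS) ⟩
    2 * (C * S * (C * S))                 ≡⟨ e₁ C S ⟩
    E * (S * S)                           ≤⟨ ℕ.*-monoʳ-≤ E (cauchy-schwarz V _) ⟩
    E * (length V * _)                    ≡⟨ cong (E *_) (cong₂ _*_ (length-vecs n k) squares) ⟩
    E * (M * ∑ U (λ x → ∑ U (G x)))       ≡⟨ e₂ E M _ ⟩
    M * (E * ∑ U (λ x → ∑ U (G x)))       ≤⟨ ℕ.*-monoʳ-≤ M total ⟩
    M * (n * (n * M + E * M))             ≡⟨ e₃ n M E ⟩
    n * M * (n * M) + n * M * M * E       ∎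
    where
    e₁ : ∀ C S → 2 * (C * S * (C * S)) ≡ 2 * (C * C) * (S * S)
    e₁ = solve-∀
    e₂ : ∀ E M s → E * (M * s) ≡ M * (E * s)
    e₂ = solve-∀
    e₃ : ∀ n M E → M * (n * (n * M + E * M)) ≡ n * M * (n * M) + n * M * M * E
    e₃ = solve-∀

  instance
    n≢0 : NonZero n
    n≢0 = ℕ.>-nonZero (ℕ.≤-<-trans z≤n E<n)
    M≢0 : NonZero M
    M≢0 = ℕ.m^n≢0 n k
    nM≢0 : NonZero (n * M)
    nM≢0 = ℕ.m*n≢0 n M
    nMM≢0 : NonZero (n * M * M)
    nMM≢0 = ℕ.m*n≢0 (n * M) M

  -- One of the two copies of `n * M * (n * M)` in `collect` cancels, and what remains is divided by
  -- `n * M * M`.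
  n≤E : n ≤ E
  n≤E = ℕ.*-cancelˡ-≤ (n * M * M) (begin
    n * M * M * n              ≡⟨ e n M ⟩
    n * M * (n * M)            ≤⟨ ℕ.+-cancelˡ-≤ (n * M * (n * M)) _ _
                                    (ℕ.≤-trans (ℕ.≤-reflexive (cong (λ z → n * M * (n * M) + z) (sym (ℕ.+-identityʳ _)))) collect) ⟩
    n * M * M * E              ∎)
    where
    e : ∀ n M → n * M * M * n ≡ n * M * (n * M)
    e = solve-∀

-- Erdős's argument for complete `k`-partite `k`-graphs: the coordinates are doubled one after
-- another by `dense⇒denseLinks`. A dense family of empty tuples contains the empty tuple, which
-- ends the induction.
dense⇒box : ∀ n k C (f : Vec (Fin n) k → Bool) → boxThreshold k C ≤ n → Dense n k C f → Box k f
dense⇒box n zero C f _ dense with f []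
... | true  = refl
... | false = contradiction (ℕ.≤-trans dense (ℕ.≤-reflexive (ℕ.*-zeroʳ C))) λ ()
dense⇒box n (suc k) C f N≤n dense =
  let x , y , x≢y , dense′ = dense⇒denseLinks n k C f (ℕ.m+n≤o⇒m≤o _ N≤n) dense
  in  x , y , x≢y , dense⇒box n k (2 * (C * C)) _ (ℕ.m+n≤o⇒n≤o (suc (2 * (C * C))) N≤n) dense′

-- `X false i` and `X true i` are the two values at coordinate `i`; a choice `s` of sides selects
-- one factor of the conjunction built up in `Box`.
box⇒sections : ∀ {n} k (f : Vec (Fin n) k → Bool) → Box k f →
  Σ (Bool → Fin k → Fin n) λ X → (∀ i → X false i ≢ X true i) ×
    (∀ (s : Fin k → Bool) → f (Vec.tabulate (λ i → X (s i) i)) ≡ true)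
box⇒sections zero    f ok = (λ _ ()) , (λ ()) , (λ _ → ok)
box⇒sections {n} (suc k) f (x , y , x≢y , box) = X , X-distinct , X-section
  where
  rest : Σ (Bool → Fin k → Fin n) _
  rest = box⇒sections k _ box
  X : Bool → Fin (suc k) → Fin n
  X b zero    = if b then y else x
  X b (suc i) = proj₁ rest b i
  X-distinct : ∀ i → X false i ≢ X true i
  X-distinct zero    = x≢y
  X-distinct (suc i) = proj₁ (proj₂ rest) i
  X-section : ∀ (s : Fin (suc k) → Bool) → f (Vec.tabulate (λ i → X (s i) i)) ≡ true
  X-section s with s zero | proj₂ (proj₂ rest) (s ∘ suc)
  ... | false | both = ∧-conicalˡ _ _ both
  ... | true  | both = ∧-conicalʳ _ _ both

-- Tuples with distinct entries

infix 7 _∈ᵇ_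
_∈ᵇ_ : ∀ {n k} → Fin n → Vec (Fin n) k → Bool
x ∈ᵇ []      = false
x ∈ᵇ (y ∷ v) = ⌊ x ≟ᶠ y ⌋ ∨ x ∈ᵇ v

distinctᵇ : ∀ {n k} → Vec (Fin n) k → Bool
distinctᵇ []      = true
distinctᵇ (x ∷ v) = not (x ∈ᵇ v) ∧ distinctᵇ v

∈ᵇ-lookup : ∀ {n k} (v : Vec (Fin n) k) i → lookup v i ∈ᵇ v ≡ true
∈ᵇ-lookup (x ∷ v) zero with x ≟ᶠ x
... | yes _   = refl
... | no  x≢x = contradiction refl x≢x
∈ᵇ-lookup (x ∷ v) (suc i) = trans (cong (⌊ lookup v i ≟ᶠ x ⌋ ∨_) (∈ᵇ-lookup v i)) (𝔹.∨-zeroʳ ⌊ lookup v i ≟ᶠ x ⌋)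

distinctᵇ⇒injective : ∀ {n k} (v : Vec (Fin n) k) → distinctᵇ v ≡ true → Injective _≡_ _≡_ (lookup v)
distinctᵇ⇒injective (x ∷ v) d {zero}  {zero}  eq = refl
distinctᵇ⇒injective (x ∷ v) d {zero}  {suc j} eq =
  contradiction (trans (sym (cong (λ b → not (b ∈ᵇ v)) eq)) (∧-conicalˡ _ _ d))
    (λ e → contradiction (trans (sym (cong not (∈ᵇ-lookup v j))) e) λ ())
distinctᵇ⇒injective (x ∷ v) d {suc i} {zero}  eq =
  contradiction (trans (cong (λ b → not (b ∈ᵇ v)) eq) (∧-conicalˡ _ _ d))
    (λ e → contradiction (trans (sym (cong not (∈ᵇ-lookup v i))) e) λ ())
distinctᵇ⇒injective (x ∷ v) d {suc i} {suc j} eq =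
  cong suc (distinctᵇ⇒injective v (∧-conicalʳ _ _ d) eq)

∑-∈ᵇ : ∀ {n k} (v : Vec (Fin n) k) → ∑ (allFin n) (λ x → ⟦ x ∈ᵇ v ⟧) ≤ k
∑-∈ᵇ {n} []      = ℕ.≤-reflexive (trans (∑-const (allFin n) 0) (ℕ.*-zeroʳ (length (allFin n))))
∑-∈ᵇ {n} {suc k} (y ∷ v) = begin
  ∑ U (λ x → ⟦ ⌊ x ≟ᶠ y ⌋ ∨ x ∈ᵇ v ⟧)                     ≤⟨ ∑-mono U (λ x → ⟦∨⟧ ⌊ x ≟ᶠ y ⌋ (x ∈ᵇ v)) ⟩
  ∑ U (λ x → ⟦ ⌊ x ≟ᶠ y ⌋ ⟧ + ⟦ x ∈ᵇ v ⟧)                 ≡⟨ ∑-+ U _ _ ⟩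
  ∑ U (λ x → ⟦ ⌊ x ≟ᶠ y ⌋ ⟧) + ∑ U (λ x → ⟦ x ∈ᵇ v ⟧)     ≤⟨ ℕ.+-mono-≤ (ℕ.≤-reflexive (∑-δ y)) (∑-∈ᵇ v) ⟩
  suc k                                                    ∎
  where
  open ℕ.≤-Reasoning
  U : List (Fin n)
  U = allFin n

-- A new head repeats an entry of its tail for at most `k` values; the other bad tuples have a bad
-- tail. The factor `n` stands on the left to avoid the exponent `k - 1`.
∑-repeats : ∀ n k → n * ∑ (vecs n k) (λ v → ⟦ not (distinctᵇ v) ⟧) ≤ k * k * n ^ k
∑-repeats n zero    = ℕ.≤-reflexive (ℕ.*-zeroʳ n)
∑-repeats n (suc k) = begin
  n * ∑ (vecs n (suc k)) (λ v → ⟦ not (distinctᵇ v) ⟧)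
    ≡⟨ cong (n *_) (∑-vecs n k _) ⟩
  n * ∑ U (λ x → ∑ V (λ v → ⟦ not (not (x ∈ᵇ v) ∧ distinctᵇ v) ⟧))
    ≤⟨ ℕ.*-monoʳ-≤ n (∑-mono U (λ x → ∑-mono V (λ v → either (x ∈ᵇ v) (distinctᵇ v)))) ⟩
  n * ∑ U (λ x → ∑ V (λ v → ⟦ x ∈ᵇ v ⟧ + ⟦ not (distinctᵇ v) ⟧))
    ≡⟨ cong (n *_) (trans (∑-cong U (λ x → ∑-+ V _ _)) (∑-+ U _ _)) ⟩
  n * (∑ U (λ x → ∑ V (λ v → ⟦ x ∈ᵇ v ⟧)) + ∑ U (λ _ → r))
    ≡⟨ cong (n *_) (cong₂ _+_ (∑-swap U V _) (trans (∑-const U r) (cong (_* r) (length-allFin n)))) ⟩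
  n * (∑ V (λ v → ∑ U (λ x → ⟦ x ∈ᵇ v ⟧)) + n * r)
    ≤⟨ ℕ.*-monoʳ-≤ n (ℕ.+-mono-≤ (∑-mono V ∑-∈ᵇ) (∑-repeats n k)) ⟩
  n * (∑ V (λ _ → k) + k * k * n ^ k)
    ≡⟨ cong (λ c → n * (c + k * k * n ^ k)) (trans (∑-const V k) (cong (_* k) (length-vecs n k))) ⟩
  n * (n ^ k * k + k * k * n ^ k)
    ≤⟨ ℕ.m≤m+n _ (suc k * (n * n ^ k)) ⟩
  n * (n ^ k * k + k * k * n ^ k) + suc k * (n * n ^ k)
    ≡⟨ collect n (n ^ k) k ⟩
  suc k * suc k * (n * n ^ k) ∎
  where
  open ℕ.≤-Reasoning
  U : List (Fin n)
  U = allFin n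
  V : List (Vec (Fin n) k)
  V = vecs n k
  r : ℕ
  r = ∑ V (λ v → ⟦ not (distinctᵇ v) ⟧)
  either : ∀ a b → ⟦ not (not a ∧ b) ⟧ ≤ ⟦ a ⟧ + ⟦ not b ⟧
  either true  b = s≤s z≤n
  either false b = ℕ.≤-refl
  collect : ∀ n m k → n * (m * k + k * k * m) + suc k * (n * m) ≡ suc k * suc k * (n * m)
  collect = solve-∀

-- For `n > 2Ck²` the tuples with a repetition make up at most a proportion `1/(2C)`, so at least
-- half of the density survives their removal.
dense-distinct : ∀ n k C (f : Vec (Fin n) k → Bool) → suc (2 * C * (k * k)) ≤ n →
  Dense n k C f → Dense n k (2 * C) (λ v → f v ∧ distinctᵇ v)
dense-distinct n k C f N≤n dense = ℕ.+-cancelʳ-≤ (n ^ k) _ _ (begin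
  n ^ k + n ^ k                          ≤⟨ ℕ.+-mono-≤ dense′ dense′ ⟩
  C * (s + r) + C * (s + r)              ≡⟨ e₁ C s r ⟩
  2 * C * s + 2 * C * r                  ≤⟨ ℕ.+-monoʳ-≤ (2 * C * s) few ⟩
  2 * C * s + n ^ k                      ∎)
  where
  open ℕ.≤-Reasoning
  V : List (Vec (Fin n) k)
  V = vecs n k
  s r : ℕ
  s = ∑ V (λ v → ⟦ f v ∧ distinctᵇ v ⟧)
  r = ∑ V (λ v → ⟦ not (distinctᵇ v) ⟧)
  instance
    n≢0 : NonZero n
    n≢0 = ℕ.>-nonZero (ℕ.≤-trans (s≤s z≤n) N≤n)
  e₁ : ∀ C s r → C * (s + r) + C * (s + r) ≡ 2 * C * s + 2 * C * r
  e₁ = solve-∀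
  e₂ : ∀ n C r → n * (2 * C * r) ≡ 2 * C * (n * r)
  e₂ = solve-∀
  split : ∀ a b → ⟦ a ⟧ ≤ ⟦ a ∧ b ⟧ + ⟦ not b ⟧
  split false b     = z≤n
  split true  false = ℕ.≤-refl
  split true  true  = ℕ.≤-refl
  dense′ : n ^ k ≤ C * (s + r)
  dense′ = ℕ.≤-trans dense (ℕ.*-monoʳ-≤ C (ℕ.≤-trans
    (∑-mono V (λ v → split (f v) (distinctᵇ v))) (ℕ.≤-reflexive (∑-+ V _ _))))
  few : 2 * C * r ≤ n ^ k
  few = ℕ.*-cancelˡ-≤ n (begin
    n * (2 * C * r)          ≡⟨ e₂ n C r ⟩
    2 * C * (n * r)          ≤⟨ ℕ.*-monoʳ-≤ (2 * C) (∑-repeats n k) ⟩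
    2 * C * (k * k * n ^ k)  ≡⟨ ℕ.*-assoc (2 * C) (k * k) (n ^ k) ⟨
    2 * C * (k * k) * n ^ k  ≤⟨ ℕ.*-monoˡ-≤ (n ^ k) (ℕ.<⇒≤ N≤n) ⟩
    n * n ^ k                ∎)

-- From boxes to copies of a 3-graph

module _ {n k : ℕ} (H : 3Graph n) (F : Small3Graph) (h : Fin (size F) → Fin k)
  (β : Fin (size F) → Bool) (hβ-injective : ∀ i j → h i ≡ h j → β i ≡ β j → i ≡ j)
  (f : Vec (Fin n) k → Bool)
  (f-edges : ∀ v → f v ≡ true → All (λ { (a , b , c) →
     edge H (lookup v (h a)) (lookup v (h b)) (lookup v (h c)) ≡ true }) (edges F)) where

  private
    f′ : Vec (Fin n) k → Bool
    f′ v = f v ∧ distinctᵇ v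

  -- Vertex `i` goes to side `β i` of coordinate `h i`. Two vertices with equal `h` lie on different
  -- sides; two with different `h` lie on a common section, whose entries are distinct. The vertices
  -- of an edge have different values of `h`, because an edge of `H` has distinct vertices, so one
  -- section passes through all three images.
  sections⇒contains : (X : Bool → Fin k → Fin n) → (∀ i → X false i ≢ X true i) →
    (∀ (s : Fin k → Bool) → f′ (Vec.tabulate (λ i → X (s i) i)) ≡ true) → Contains H F
  sections⇒contains X X-distinct X-section = φ , φ-injective _ _ , All.tabulate φ-edge
    where
    φ : Fin (size F) → Fin n
    φ i = X (β i) (h i)

    section : (Fin k → Bool) → Vec (Fin n) k
    section s = Vec.tabulate (λ j → X (s j) j)
    section-φ : ∀ s i → s (h i) ≡ β i → lookup (section s) (h i) ≡ φ i
    section-φ s i eq = trans (lookup∘tabulate _ (h i)) (cong (λ b → X b (h i)) eq)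
    section-injective : ∀ s → Injective _≡_ _≡_ (lookup (section s))
    section-injective s = distinctᵇ⇒injective (section s) (∧-conicalʳ _ _ (X-section s))

    at : Fin k → Bool → (Fin k → Bool) → Fin k → Bool
    at i b s j = if ⌊ j ≟ᶠ i ⌋ then b else s j
    at-same : ∀ i b s → at i b s i ≡ b
    at-same i b s with i ≟ᶠ i
    ... | yes _   = refl
    ... | no  i≢i = contradiction refl i≢i
    at-other : ∀ i b s {j} → j ≢ i → at i b s j ≡ s j
    at-other i b s {j} j≢i with j ≟ᶠ i
    ... | yes j≡i = contradiction j≡i j≢i
    ... | no  _   = refl

    φ-injective : ∀ i j → φ i ≡ φ j → i ≡ j
    φ-injective i j eq with h i ≟ᶠ h j
    φ-injective i j eq | yes hi≡hj = hβ-injective i j hi≡hj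
      (same (h j) (β i) (β j) (trans (cong (X (β i)) (sym hi≡hj)) eq))
      where
      same : ∀ l b c → X b l ≡ X c l → b ≡ c
      same l false false _  = refl
      same l false true  eq = contradiction eq (X-distinct l)
      same l true  false eq = contradiction (sym eq) (X-distinct l)
      same l true  true  _  = refl
    φ-injective i j eq | no hi≢hj = contradiction
      (section-injective s (trans (section-φ s i (at-same (h i) (β i) s′))
        (trans eq (sym (section-φ s j (at-other (h i) (β i) s′ (λ e → hi≢hj (sym e))))))))
      hi≢hj
      where
      s′ s : Fin k → Bool
      s′ = λ _ → β j
      s  = at (h i) (β i) s′

    φ-edge : ∀ {t} → t ∈ edges F →
      edge H (φ (proj₁ t)) (φ (proj₁ (proj₂ t))) (φ (proj₂ (proj₂ t))) ≡ true
    φ-edge {a , b , c} t∈F = subst (_≡ true)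
      (cong₃ (section-φ s a (at-same (h a) (β a) s′))
             (section-φ s b (trans (at-other (h a) (β a) s′ (λ e → proj₁ apart (sym e)))
                                   (at-same (h b) (β b) s″)))
             (section-φ s c (trans (at-other (h a) (β a) s′ (λ e → proj₂ (proj₂ apart) (sym e)))
                                   (at-other (h b) (β b) s″ (λ e → proj₁ (proj₂ apart) (sym e))))))
      (edge-at s)
      where
      cong₃ : ∀ {x x′ y y′ z z′} → x ≡ x′ → y ≡ y′ → z ≡ z′ → edge H x y z ≡ edge H x′ y′ z′
      cong₃ refl refl refl = refl
      edge-at : ∀ s → edge H (lookup (section s) (h a)) (lookup (section s) (h b)) (lookup (section s) (h c)) ≡ true
      edge-at s = All.lookup (f-edges (section s) (∧-conicalˡ _ _ (X-section s))) t∈F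
      apart : (h a ≢ h b) × (h b ≢ h c) × (h a ≢ h c)
      apart = let x≢y , y≢z , x≢z = distinct H _ _ _ (edge-at (λ _ → false))
                  L = lookup (section (λ _ → false))
              in (λ e → x≢y (cong L e)) , (λ e → y≢z (cong L e)) , (λ e → x≢z (cong L e))
      s″ s′ s : Fin k → Bool
      s″ = λ _ → β c
      s′ = at (h b) (β b) s″
      s  = at (h a) (β a) s′

  -- β tells apart the (at most two) vertices of a fibre of h.
  dense⇒contains : ∀ C → suc (2 * C * (k * k)) + boxThreshold k (2 * C) ≤ n →
    Dense n k C f → Contains H F
  dense⇒contains C N≤n dense =
    let X , X-distinct , X-section = box⇒sections k f′
          (dense⇒box n k (2 * C) f′ (ℕ.m+n≤o⇒n≤o (suc (2 * C * (k * k))) N≤n)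
            (dense-distinct n k C f (ℕ.m+n≤o⇒m≤o _ N≤n) dense))
    in sections⇒contains X X-distinct X-section

-- Patterns of positive density and their extensions

Triple : ℕ → Set
Triple k = Fin k × Fin k × Fin k

Pattern : ℕ → Set
Pattern k = List (Triple k)

mapTriple : ∀ {k m} → (Fin k → Fin m) → Triple k → Triple m
mapTriple g (a , b , c) = g a , g b , g c

edgeᵗ : ∀ {n} → 3Graph n → Triple n → Bool
edgeᵗ H (a , b , c) = edge H a b c

realises : ∀ {n k} → 3Graph n → (Fin k → Fin n) → Pattern k → Bool
realises H φ []      = true
realises H φ (t ∷ P) = edgeᵗ H (mapTriple φ t) ∧ realises H φ P

realises-map : ∀ {n k m} (H : 3Graph n) (φ : Fin m → Fin n) (σ : Fin k → Fin m) (P : Pattern k) →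
  realises H φ (map (mapTriple σ) P) ≡ realises H (φ ∘ σ) P
realises-map H φ σ []      = refl
realises-map H φ σ (t ∷ P) = cong (edgeᵗ H (mapTriple (φ ∘ σ) t) ∧_) (realises-map H φ σ P)

realises⇒All : ∀ {n k} (H : 3Graph n) (φ : Fin k → Fin n) (P : Pattern k) → realises H φ P ≡ true →
  All (λ { (a , b , c) → edge H (φ a) (φ b) (φ c) ≡ true }) P
realises⇒All H φ []      _  = []
realises⇒All H φ (t ∷ P) eq = ∧-conicalˡ _ _ eq ∷ realises⇒All H φ P (∧-conicalʳ _ _ eq)

∨-elim : ∀ {a b} {A : Set} → (a ≡ true → A) → (b ≡ true → A) → a ∨ b ≡ true → A
∨-elim {true}  f g _  = f refl
∨-elim {false} f g eq = g eq

-- A test that computes on closed terms without building proofs; the searches that are settled by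
-- `refl` run it during type checking.
_==_ : ∀ {k} → Fin k → Fin k → Bool
zero  == zero  = true
zero  == suc _ = false
suc _ == zero  = false
suc i == suc j = i == j

==⇒≡ : ∀ {k} (i j : Fin k) → i == j ≡ true → i ≡ j
==⇒≡ zero    zero    _  = refl
==⇒≡ (suc i) (suc j) eq = cong suc (==⇒≡ i j eq)

sameEdge : ∀ {k} → Triple k → Triple k → Bool
sameEdge (a , b , c) (x , y , z) =
  (a == x ∧ (b == y ∧ c == z ∨ b == z ∧ c == y)) ∨
  (a == y ∧ (b == x ∧ c == z ∨ b == z ∧ c == x)) ∨
  (a == z ∧ (b == x ∧ c == y ∨ b == y ∧ c == x))

sameEdge-sound : ∀ {n k} (H : 3Graph n) (φ : Fin k → Fin n) (s t : Triple k) →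
  sameEdge s t ≡ true → edgeᵗ H (mapTriple φ s) ≡ edgeᵗ H (mapTriple φ t)
sameEdge-sound H φ (a , b , c) (x , y , z) =
  ∨-elim (both a x λ { refl → ∨-elim (both b y λ { refl → single c z λ { refl → refl } })
                                     (both b z λ { refl → single c y λ { refl → sym₂₃ H _ _ _ } }) })
 (∨-elim (both a y λ { refl → ∨-elim (both b x λ { refl → single c z λ { refl → sym₁₂ H _ _ _ } })
                                     (both b z λ { refl → single c x λ { refl → trans (sym₂₃ H _ _ _) (sym₁₂ H _ _ _) } }) })
         (both a z λ { refl → ∨-elim (both b x λ { refl → single c y λ { refl → trans (sym₁₂ H _ _ _) (sym₂₃ H _ _ _) } })
                                     (both b y λ { refl → single c x λ { refl → trans (sym₂₃ H _ _ _) (trans (sym₁₂ H _ _ _) (sym₂₃ H _ _ _)) } }) }))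
  where
  single : ∀ {k} (i j : Fin k) {A : Set} → (i ≡ j → A) → i == j ≡ true → A
  single i j f eq = f (==⇒≡ i j eq)
  both : ∀ {k} (i j : Fin k) {b} {A : Set} → (i ≡ j → b ≡ true → A) → i == j ∧ b ≡ true → A
  both i j f eq = f (==⇒≡ i j (∧-conicalˡ _ _ eq)) (∧-conicalʳ (i == j) _ eq)

_∈ᵖ_ : ∀ {k} → Triple k → Pattern k → Bool
t ∈ᵖ []      = false
t ∈ᵖ (s ∷ P) = sameEdge t s ∨ t ∈ᵖ P

_⊆ᵖ_ : ∀ {k} → Pattern k → Pattern k → Bool
[]      ⊆ᵖ P = true
(t ∷ Q) ⊆ᵖ P = t ∈ᵖ P ∧ Q ⊆ᵖ P

∈ᵖ-sound : ∀ {n k} (H : 3Graph n) (φ : Fin k → Fin n) (t : Triple k) (P : Pattern k) →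
  t ∈ᵖ P ≡ true → realises H φ P ≡ true → edgeᵗ H (mapTriple φ t) ≡ true
∈ᵖ-sound H φ t (s ∷ P) t∈P r = ∨-elim
  (λ same → trans (sameEdge-sound H φ t s same) (∧-conicalˡ _ _ r))
  (λ t∈P′ → ∈ᵖ-sound H φ t P t∈P′ (∧-conicalʳ _ _ r)) t∈P

⊆ᵖ-sound : ∀ {n k} (H : 3Graph n) (φ : Fin k → Fin n) (Q P : Pattern k) →
  Q ⊆ᵖ P ≡ true → realises H φ P ≡ true → realises H φ Q ≡ true
⊆ᵖ-sound H φ []      P _  r = refl
⊆ᵖ-sound H φ (t ∷ Q) P Q⊆P r = cong₂ _∧_
  (∈ᵖ-sound H φ t P (∧-conicalˡ _ _ Q⊆P) r) (⊆ᵖ-sound H φ Q P (∧-conicalʳ (t ∈ᵖ P) _ Q⊆P) r)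

-- The inequality says `κ ≥ (2/5 + 1/(5D)) n`, so `1/(5D)` plays the part of ε.
Heavy : ∀ {n} → ℕ → 3Graph n → ℕ → Set
Heavy {n} D H κ = (∀ x y → InSomeEdge H x y → κ ≤ codeg H x y) × (2 * D * n + n ≤ 5 * D * κ)

-- `g` places the vertices of `P` among the coordinates, so that a relabelled pattern is handled by
-- composing with `g` and the tuples stay as they are. `f` is any family of realising tuples, which
-- leaves room for further conditions on them.
SparseFrom : ∀ {k m} → ℕ → Pattern k → (Fin k → Fin m) → ℕ → ℕ → Set
SparseFrom {k} {m} D P g C N = ∀ n → N ≤ n → (H : 3Graph n) (κ : ℕ) → FFree F₁ H → Heavy D H κ →
  (f : Vec (Fin n) m → Bool) → (∀ v → f v ≡ true → realises H (lookup v ∘ g) P ≡ true) →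
  ¬ Dense n m C f

record Sparse {k : ℕ} (D : ℕ) (P : Pattern k) : Set where
  constructor sparse
  field
    sparseFrom : ∀ {m} (g : Fin k → Fin m) → Injective _≡_ _≡_ g → ∀ C → Σ ℕ (SparseFrom D P g C)
open Sparse public

sparse-map : ∀ {D k m} (P : Pattern k) (σ : Fin k → Fin m) → Injective _≡_ _≡_ σ →
  Sparse D P → Sparse D (map (mapTriple σ) P)
sparse-map P σ σ-inj s = sparse λ g g-inj C →
  let N , s = sparseFrom s (g ∘ σ) (σ-inj ∘ g-inj) C
  in N , λ n N≤n H κ free heavy f f⇒ → s n N≤n H κ free heavy f
       (λ v fv → trans (sym (realises-map H (lookup v ∘ g) σ P)) (f⇒ v fv))

image : ∀ {k} → Vec (Fin k) 7 → Pattern k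
image h = map (mapTriple (lookup h)) (edges F₁)

-- Tells whether the entry occurs again later on: in a fibre of size two this holds for the first
-- element and fails for the second, so it serves as `β`. In a larger fibre two elements agree, and
-- `FibresOfSize≤2` fails.
repeated : ∀ {k m} → Vec (Fin k) m → Fin m → Bool
repeated (x ∷ v) zero    = x ∈ᵇ v
repeated (x ∷ v) (suc i) = repeated v i

FibresOfSize≤2 : ∀ {k m} → Vec (Fin k) m → Set
FibresOfSize≤2 h = ∀ i j → lookup h i ≡ lookup h j → repeated h i ≡ repeated h j → i ≡ j

fibresOfSize≤2? : ∀ {k m} (h : Vec (Fin k) m) → Dec (FibresOfSize≤2 h)
fibresOfSize≤2? h = 𝔽.all? λ i → 𝔽.all? λ j →
  (lookup h i ≟ᶠ lookup h j) →-dec ((repeated h i 𝔹.≟ repeated h j) →-dec (i ≟ᶠ j))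

image-sparse : ∀ {D k} (h : Vec (Fin k) 7) → FibresOfSize≤2 h → Sparse D (image h)
image-sparse h fibres = sparse λ g g-inj C →
  -- The threshold is the one that `dense⇒contains` asks for and is found by unification.
  _ , λ n N≤n H κ free heavy f f⇒ dense → free
    (dense⇒contains H F₁ (g ∘ lookup h) (repeated h) (λ i j eq → fibres i j (g-inj eq)) f
      (λ v fv → realises⇒All H (lookup v ∘ g ∘ lookup h) (edges F₁)
        (trans (sym (realises-map H (lookup v ∘ g) (lookup h) (edges F₁))) (f⇒ v fv)))
      C N≤n dense)

-- A triple `(a , b , c)` with weight `w` puts `w` on the pair `ab`; `c` only names an edge `abc` of
-- the pattern that shows the pair to be covered.
Weighting : ℕ → Set
Weighting k = List (ℕ × Triple k)

total : ∀ {k} → Weighting k → ℕ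
total []             = 0
total ((w , _) ∷ ws) = w + total ws

cone : ∀ {k} → Triple k → Triple (suc k)
cone (a , b , _) = zero , suc a , suc b

linkWeight : ∀ {n k} → 3Graph n → Fin n → (Fin k → Fin n) → Weighting k → ℕ
linkWeight H z φ []                       = 0
linkWeight H z φ ((w , a , b , _) ∷ ws) = w * ⟦ edge H z (φ a) (φ b) ⟧ + linkWeight H z φ ws

anyᵇ : {A : Set} → (A → Bool) → List A → Bool
anyᵇ p []       = false
anyᵇ p (x ∷ xs) = p x ∨ anyᵇ p xs

anyᵇ-sound : {A : Set} (p : A → Bool) (xs : List A) → anyᵇ p xs ≡ true → Σ A λ x → x ∈ xs × p x ≡ true
anyᵇ-sound p (x ∷ xs) = ∨-elim (λ px → x , here refl , px)
  (λ eq → let y , y∈xs , py = anyᵇ-sound p xs eq in y , there y∈xs , py)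

discard : {A : Set} → (A → Bool) → List A → List A
discard p []       = []
discard p (x ∷ xs) = if p x then discard p xs else x ∷ discard p xs

discard-⊆ : {A : Set} (p : A → Bool) (xs : List A) {x : A} → x ∈ discard p xs → x ∈ xs
discard-⊆ p (y ∷ xs) x∈ with p y | x∈
... | true  | x∈′       = there (discard-⊆ p xs x∈′)
... | false | here eq   = here eq
... | false | there x∈′ = there (discard-⊆ p xs x∈′)

-- forces B got ws Q Os: whenever Q is realised and the link of the vertex 0 on the pairs of ws brings
-- the weight got above B, some outcome in Os is realised as well. The search branches on whether the
-- next pair is in the link; a missing pair rules out the outcomes that use it.
forces : ∀ {k} → ℕ → ℕ → Weighting k → Pattern (suc k) → List (Pattern (suc k)) → Bool
forces B got []             Q Os = (got ℕ.≤ᵇ B) ∨ anyᵇ (_⊆ᵖ Q) Os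
forces B got ((w , t) ∷ ws) Q Os =
  (got + (w + total ws) ℕ.≤ᵇ B) ∨
  (forces B got ws Q (discard (cone t ∈ᵖ_) Os) ∧ forces B (w + got) ws (cone t ∷ Q) Os)

≤ᵇ-sound : ∀ m n → (m ℕ.≤ᵇ n) ≡ true → m ≤ n
≤ᵇ-sound m n eq = ℕ.≤ᵇ⇒≤ m n (subst T (sym eq) tt)

linkWeight≤total : ∀ {n k} (H : 3Graph n) z (φ : Fin k → Fin n) ws → linkWeight H z φ ws ≤ total ws
linkWeight≤total H z φ []                       = z≤n
linkWeight≤total H z φ ((w , a , b , _) ∷ ws) = ℕ.+-mono-≤
  (ℕ.≤-trans (ℕ.*-monoʳ-≤ w (⟦⟧≤1 (edge H z (φ a) (φ b)))) (ℕ.≤-reflexive (ℕ.*-identityʳ w)))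
  (linkWeight≤total H z φ ws)

-- Follows the branches of the search. For a missing pair, fewer outcomes make the claim stronger,
-- and `discard-⊆` carries it back; for a present pair, its cone joins `Q`. A branch is cut off once
-- even all remaining pairs cannot lift the weight above `B`.
forces-sound : ∀ {n k} (H : 3Graph n) (ψ : Fin (suc k) → Fin n) B got (ws : Weighting k) Q Os →
  forces B got ws Q Os ≡ true → realises H ψ Q ≡ true →
  (got + linkWeight H (ψ zero) (ψ ∘ suc) ws ≤ B) ⊎
  (Σ (Pattern (suc k)) λ O → O ∈ Os × realises H ψ O ≡ true)
forces-sound H ψ B got [] Q Os ok r = ∨-elim
  (λ light → inj₁ (ℕ.≤-trans (ℕ.≤-reflexive (ℕ.+-identityʳ got)) (≤ᵇ-sound got B light)))
  (λ eq → let O , O∈Os , O⊆Q = anyᵇ-sound (_⊆ᵖ Q) Os eq in inj₂ (O , O∈Os , ⊆ᵖ-sound H ψ O Q O⊆Q r)) ok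
forces-sound H ψ B got ((w , t@(a , b , c)) ∷ ws) Q Os ok r = ∨-elim
  (λ light → inj₁ (ℕ.≤-trans (ℕ.+-monoʳ-≤ got (linkWeight≤total H (ψ zero) (ψ ∘ suc) ((w , t) ∷ ws)))
                             (≤ᵇ-sound _ B light)))
  branch ok
  where
  ℓ : ℕ
  ℓ = linkWeight H (ψ zero) (ψ ∘ suc) ws
  branch : forces B got ws Q (discard (cone t ∈ᵖ_) Os) ∧ forces B (w + got) ws (cone t ∷ Q) Os ≡ true →
    (got + (w * ⟦ edge H (ψ zero) (ψ (suc a)) (ψ (suc b)) ⟧ + ℓ) ≤ B) ⊎
    (Σ (Pattern _) λ O → O ∈ Os × realises H ψ O ≡ true)
  branch both with edge H (ψ zero) (ψ (suc a)) (ψ (suc b)) in eq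
  ... | false with forces-sound H ψ B got ws Q _ (∧-conicalˡ _ _ both) r
  ...   | inj₁ light = inj₁ (subst (λ x → got + (x + ℓ) ≤ B) (sym (ℕ.*-zeroʳ w)) light)
  ...   | inj₂ (O , O∈ , rO) = inj₂ (O , discard-⊆ (cone t ∈ᵖ_) Os O∈ , rO)
  branch both | true with forces-sound H ψ B (w + got) ws (cone t ∷ Q) Os
                            (∧-conicalʳ (forces B got ws Q (discard (cone t ∈ᵖ_) Os)) _ both) (cong₂ _∧_ eq r)
  ...   | inj₁ light = inj₁ (subst (_≤ B) (shuffle w got ℓ) light)
    where
    shuffle : ∀ w got ℓ → w + got + ℓ ≡ got + (w * 1 + ℓ)
    shuffle = solve-∀
  ...   | inj₂ found = inj₂ found

-- Averaging over the links of new vertices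

Covered : ∀ {k} → Pattern k → Weighting k → Bool
Covered P []             = true
Covered P ((w , t) ∷ ws) = t ∈ᵖ P ∧ Covered P ws

∑-term : ∀ {A : Set} (xs : List A) (f : A → ℕ) {x} → x ∈ xs → f x ≤ ∑ xs f
∑-term (y ∷ xs) f (here refl) = ℕ.m≤m+n _ _
∑-term (y ∷ xs) f (there x∈)  = ℕ.≤-trans (∑-term xs f x∈) (ℕ.m≤n+m _ _)

edge⇒InSomeEdge : ∀ {n} (H : 3Graph n) {x y z} → edge H x y z ≡ true → InSomeEdge H x y
edge⇒InSomeEdge {n} H {x} {y} {z} e = ℕ.≤-trans (ℕ.≤-reflexive (cong ⟦_⟧ (sym e)))
  (∑-term (allFin n) (λ z → ⟦ edge H x y z ⟧) (∈-allFin z))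

-- Double counting: a pair of weight `w` contributes `w` times its co-degree, which is at least `κ`
-- because the pair lies in an edge of `P`.
∑-linkWeight : ∀ {n k} (H : 3Graph n) κ (φ : Fin k → Fin n) P (ws : Weighting k) →
  (∀ x y → InSomeEdge H x y → κ ≤ codeg H x y) → realises H φ P ≡ true → Covered P ws ≡ true →
  total ws * κ ≤ ∑ (allFin n) (λ z → linkWeight H z φ ws)
∑-linkWeight H κ φ P [] min r cov = z≤n
∑-linkWeight {n} H κ φ P ((w , t@(a , b , c)) ∷ ws) min r cov = begin
  (w + total ws) * κ                                         ≡⟨ ℕ.*-distribʳ-+ κ w (total ws) ⟩
  w * κ + total ws * κ
    ≤⟨ ℕ.+-mono-≤ (ℕ.*-monoʳ-≤ w (min (φ a) (φ b) (edge⇒InSomeEdge H (∈ᵖ-sound H φ t P (∧-conicalˡ _ _ cov) r))))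
                  (∑-linkWeight H κ φ P ws min r (∧-conicalʳ (t ∈ᵖ P) _ cov)) ⟩
  w * codeg H (φ a) (φ b) + ∑ U (λ z → linkWeight H z φ ws)
    ≡⟨ cong (λ s → w * s + ∑ U (λ z → linkWeight H z φ ws))
         (∑-cong U (λ z → cong ⟦_⟧ (trans (sym₂₃ H (φ a) (φ b) z) (sym₁₂ H (φ a) z (φ b))))) ⟩
  w * ∑ U (λ z → ⟦ edge H z (φ a) (φ b) ⟧) + ∑ U (λ z → linkWeight H z φ ws)
    ≡⟨ cong (_+ ∑ U (λ z → linkWeight H z φ ws)) (sym (∑-*ˡ U w _)) ⟩
  ∑ U (λ z → w * ⟦ edge H z (φ a) (φ b) ⟧) + ∑ U (λ z → linkWeight H z φ ws)
    ≡⟨ ∑-+ U _ _ ⟨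
  ∑ U (λ z → w * ⟦ edge H z (φ a) (φ b) ⟧ + linkWeight H z φ ws) ∎
  where
  open ℕ.≤-Reasoning
  U : List (Fin n)
  U = allFin n

∑-max : ∀ {A : Set} (x : A) (xs : List A) (f : A → ℕ) →
  Σ A λ y → y ∈ x ∷ xs × ∑ (x ∷ xs) f ≤ length (x ∷ xs) * f y
∑-max x []       f = x , here refl , ℕ.≤-refl
∑-max x (y ∷ ys) f with ∑-max y ys f
... | z , z∈ , bound with ℕ.≤-total (f x) (f z)
...   | inj₁ fx≤fz = z , there z∈ , ℕ.+-mono-≤ fx≤fz bound
...   | inj₂ fz≤fx = x , here refl ,
        ℕ.+-monoʳ-≤ (f x) (ℕ.≤-trans bound (ℕ.*-monoʳ-≤ (length (y ∷ ys)) fz≤fx))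

lift : ∀ {k m} → (Fin k → Fin m) → Fin (suc k) → Fin (suc m)
lift g zero    = zero
lift g (suc i) = suc (g i)

lift-injective : ∀ {k m} (g : Fin k → Fin m) → Injective _≡_ _≡_ g → Injective _≡_ _≡_ (lift g)
lift-injective g g-inj {zero}  {zero}  eq = refl
lift-injective g g-inj {suc i} {suc j} eq = cong suc (g-inj (𝔽.suc-injective eq))

sparseFrom-all : ∀ {D k m} (Os : List (Pattern k)) (g : Fin k → Fin m) → Injective _≡_ _≡_ g → ∀ C →
  All (Sparse D) Os → Σ ℕ λ N → ∀ {O} → O ∈ Os → SparseFrom D O g C N
sparseFrom-all []       g g-inj C []       = 0 , λ ()
sparseFrom-all (O ∷ Os) g g-inj C (s ∷ ss) =
  let N₁ , h₁ = sparseFrom s g g-inj C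
      N₂ , h₂ = sparseFrom-all Os g g-inj C ss
  in  N₁ + N₂ , λ { (here refl) n N≤n → h₁ n (ℕ.m+n≤o⇒m≤o _ N≤n)
                  ; (there O∈)  n N≤n → h₂ O∈ n (ℕ.m+n≤o⇒n≤o N₁ N≤n) }

module _ {D k : ℕ} (P : Pattern k) (ws : Weighting k) (Os : List (Pattern (suc k))) where

  outcome : ∀ {n m} → 3Graph n → (Fin k → Fin m) → (Vec (Fin n) m → Bool) →
    Pattern (suc k) → Vec (Fin n) (suc m) → Bool
  outcome H g f O (z ∷ v) = f v ∧ realises H (lookup (z ∷ v) ∘ lift g) O

  module _ (covered : Covered P ws ≡ true) (B : ℕ) (5B≤2W : (5 * B ℕ.≤ᵇ 2 * total ws) ≡ true)
    (positive : (1 ℕ.≤ᵇ total ws) ≡ true)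
    (forced : forces B 0 ws (map (mapTriple suc) P) Os ≡ true) where

    private
      W : ℕ
      W = total ws
      instance
        W≢0 : NonZero W
        W≢0 = ℕ.>-nonZero (≤ᵇ-sound 1 W positive)

    -- A vertex `z` that completes no outcome has at most `2/5` of the weight in its link, any other
    -- at most all of it. Comparison with the average gives `5κ ≤ 2n + 5G`, where `G` counts
    -- completed outcomes, and the surplus in `Heavy` leaves `n ≤ 5DG`.
    outcome-degree : ∀ {n m} (H : 3Graph n) κ → Heavy D H κ → (g : Fin k → Fin m) (f : Vec (Fin n) m → Bool) →
      (∀ v → f v ≡ true → realises H (lookup v ∘ g) P ≡ true) → ∀ v →
      n * ⟦ f v ⟧ ≤ 5 * D * ∑ (allFin n) (λ z → ∑ Os (λ O → ⟦ outcome H g f O (z ∷ v) ⟧))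
    outcome-degree {n} H κ (min , heavy) g f f⇒ v with f v in fv
    ... | false = ℕ.≤-trans (ℕ.≤-reflexive (ℕ.*-zeroʳ n)) z≤n
    ... | true  = ℕ.≤-trans (ℕ.≤-reflexive (ℕ.*-identityʳ n)) (ℕ.+-cancelˡ-≤ (2 * D * n) _ _ (begin
      2 * D * n + n                    ≤⟨ heavy ⟩
      5 * D * κ                        ≡⟨ e₁ D κ ⟩
      D * (5 * κ)                      ≤⟨ ℕ.*-monoʳ-≤ D 5κ≤ ⟩
      D * (2 * n + 5 * G)              ≡⟨ e₂ D n G ⟩
      2 * D * n + 5 * D * G            ∎))
      where
      open ℕ.≤-Reasoning
      U : List (Fin n)
      U = allFin n
      φ : Fin k → Fin n
      φ = lookup v ∘ g
      ψ : Fin n → Fin (suc k) → Fin n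
      ψ z = lookup (z ∷ v) ∘ lift g
      good : Fin n → ℕ
      good z = ∑ Os (λ O → ⟦ realises H (ψ z) O ⟧)
      G : ℕ
      G = ∑ U good
      e₁ : ∀ D κ → 5 * D * κ ≡ D * (5 * κ)
      e₁ = solve-∀
      e₂ : ∀ D n G → D * (2 * n + 5 * G) ≡ 2 * D * n + 5 * D * G
      e₂ = solve-∀
      e₃ : ∀ W κ → W * (5 * κ) ≡ 5 * (W * κ)
      e₃ = solve-∀
      e₄ : ∀ W n G → n * (2 * W) + 5 * W * G ≡ W * (2 * n + 5 * G)
      e₄ = solve-∀

      link-bound : ∀ z → 5 * linkWeight H z φ ws ≤ 2 * W + 5 * W * good z
      link-bound z with forces-sound H (ψ z) B 0 ws (map (mapTriple suc) P) Os forced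
                          (trans (realises-map H (ψ z) suc P) (f⇒ v fv))
      ... | inj₁ light = ℕ.≤-trans (ℕ.≤-trans (ℕ.*-monoʳ-≤ 5 light) (≤ᵇ-sound (5 * B) (2 * W) 5B≤2W)) (ℕ.m≤m+n _ _)
      ... | inj₂ (O , O∈Os , r) = begin
        5 * linkWeight H z φ ws   ≤⟨ ℕ.*-monoʳ-≤ 5 (linkWeight≤total H z φ ws) ⟩
        5 * W                     ≡⟨ ℕ.*-identityʳ (5 * W) ⟨
        5 * W * 1                 ≤⟨ ℕ.*-monoʳ-≤ (5 * W) (ℕ.≤-trans (ℕ.≤-reflexive (cong ⟦_⟧ (sym r)))
                                       (∑-term Os (λ O → ⟦ realises H (ψ z) O ⟧) O∈Os)) ⟩
        5 * W * good z            ≤⟨ ℕ.m≤n+m _ (2 * W) ⟩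
        2 * W + 5 * W * good z    ∎

      5κ≤ : 5 * κ ≤ 2 * n + 5 * G
      5κ≤ = ℕ.*-cancelˡ-≤ W (begin
        W * (5 * κ)                               ≡⟨ e₃ W κ ⟩
        5 * (W * κ)                               ≤⟨ ℕ.*-monoʳ-≤ 5 (∑-linkWeight H κ φ P ws min (f⇒ v fv) covered) ⟩
        5 * ∑ U (λ z → linkWeight H z φ ws)       ≡⟨ ∑-*ˡ U 5 _ ⟨
        ∑ U (λ z → 5 * linkWeight H z φ ws)       ≤⟨ ∑-mono U link-bound ⟩
        ∑ U (λ z → 2 * W + 5 * W * good z)        ≡⟨ ∑-+ U _ _ ⟩
        ∑ U (λ _ → 2 * W) + ∑ U (λ z → 5 * W * good z)
          ≡⟨ cong₂ _+_ (trans (∑-const U (2 * W)) (cong (_* (2 * W)) (length-allFin n))) (∑-*ˡ U (5 * W) good) ⟩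
        n * (2 * W) + 5 * W * G                   ≡⟨ e₄ W n G ⟩
        W * (2 * n + 5 * G)                       ∎)

    outcome-dense : ∀ {n m} (H : 3Graph n) κ → Heavy D H κ → (g : Fin k → Fin m) (f : Vec (Fin n) m → Bool) →
      (∀ v → f v ≡ true → realises H (lookup v ∘ g) P ≡ true) → ∀ C → Dense n m C f →
      n ^ suc m ≤ C * (5 * D) * ∑ Os (λ O → ∑ (vecs n (suc m)) (λ v → ⟦ outcome H g f O v ⟧))
    outcome-dense {n} {m} H κ heavy g f f⇒ C dense = begin
      n * n ^ m                                 ≤⟨ ℕ.*-monoʳ-≤ n dense ⟩
      n * (C * ∑ V (λ v → ⟦ f v ⟧))             ≡⟨ e₁ n C _ ⟩
      C * (n * ∑ V (λ v → ⟦ f v ⟧))             ≡⟨ cong (C *_) (sym (∑-*ˡ V n _)) ⟩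
      C * ∑ V (λ v → n * ⟦ f v ⟧)
        ≤⟨ ℕ.*-monoʳ-≤ C (∑-mono V (outcome-degree H κ heavy g f f⇒)) ⟩
      C * ∑ V (λ v → 5 * D * ∑ U (λ z → ∑ Os (λ O → ⟦ outcome H g f O (z ∷ v) ⟧)))
        ≡⟨ cong (C *_) (∑-*ˡ V (5 * D) _) ⟩
      C * (5 * D * ∑ V (λ v → ∑ U (λ z → ∑ Os (λ O → ⟦ outcome H g f O (z ∷ v) ⟧))))
        ≡⟨ ℕ.*-assoc C (5 * D) _ ⟨
      C * (5 * D) * ∑ V (λ v → ∑ U (λ z → ∑ Os (λ O → ⟦ outcome H g f O (z ∷ v) ⟧)))
        ≡⟨ cong (C * (5 * D) *_) (trans (∑-swap V U _) (sym (∑-vecs n m (λ v → ∑ Os (λ O → ⟦ outcome H g f O v ⟧))))) ⟩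
      C * (5 * D) * ∑ (vecs n (suc m)) (λ v → ∑ Os (λ O → ⟦ outcome H g f O v ⟧))
        ≡⟨ cong (C * (5 * D) *_) (∑-swap (vecs n (suc m)) Os _) ⟩
      C * (5 * D) * ∑ Os (λ O → ∑ (vecs n (suc m)) (λ v → ⟦ outcome H g f O v ⟧)) ∎
      where
      open ℕ.≤-Reasoning
      U : List (Fin n)
      U = allFin n
      V : List (Vec (Fin n) m)
      V = vecs n m
      e₁ : ∀ n C s → n * (C * s) ≡ C * (n * s)
      e₁ = solve-∀

    -- If `P` were dense, the outcomes together would be dense by `outcome-dense`, and by pigeonhole
    -- a single one would have density `1/C′`, contrary to its sparseness.
    sparse-extend : All (Sparse D) Os → Sparse D P
    sparse-extend outcomes-sparse = sparse sparse-from
      where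
      module _ {m} (g : Fin k → Fin m) (g-inj : Injective _≡_ _≡_ g) (C : ℕ) where
        C′ : ℕ
        C′ = C * (5 * D) * length Os
        all-sparse : Σ ℕ λ N → ∀ {O} → O ∈ Os → SparseFrom D O (lift g) C′ N
        all-sparse = sparseFrom-all Os (lift g) (lift-injective g g-inj) C′ outcomes-sparse
        N : ℕ
        N = proj₁ all-sparse
        -- The successor makes `n` nonzero, so that an empty list of outcomes is absurd as well.
        no-dense : SparseFrom D P g C (suc N)
        no-dense n N<n H κ free heavy f f⇒ dense = pick Os refl (outcome-dense H κ heavy g f f⇒ C dense)
          where
          open ℕ.≤-Reasoning
          S : Pattern (suc k) → ℕ
          S O = ∑ (vecs n (suc m)) (λ v → ⟦ outcome H g f O v ⟧)
          instance
            n≢0 : NonZero n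
            n≢0 = ℕ.>-nonZero (ℕ.≤-trans (s≤s z≤n) N<n)
          -- `Os` is a module parameter, so the case distinction is made on a copy of it together
          -- with an equation.
          pick : ∀ Os′ → Os′ ≡ Os → n ^ suc m ≤ C * (5 * D) * ∑ Os′ S → ⊥
          pick [] _ le = ℕ.<⇒≱ (ℕ.m^n>0 n (suc m)) (ℕ.≤-trans le (ℕ.≤-reflexive (ℕ.*-zeroʳ (C * (5 * D)))))
          pick (O₀ ∷ Os₀) refl le =
            let O , O∈Os , max = ∑-max O₀ Os₀ S in
            proj₂ all-sparse O∈Os n (ℕ.<⇒≤ N<n) H κ free heavy (outcome H g f O)
              (λ { (z ∷ v) eq → ∧-conicalʳ (f v) _ eq })
              (begin
                n ^ suc m                                 ≤⟨ le ⟩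
                C * (5 * D) * ∑ Os S                      ≤⟨ ℕ.*-monoʳ-≤ (C * (5 * D)) max ⟩
                C * (5 * D) * (length Os * S O)           ≡⟨ ℕ.*-assoc (C * (5 * D)) (length Os) (S O) ⟨
                C′ * S O                                  ∎)
      sparse-from : ∀ {m} (g : Fin k → Fin m) → Injective _≡_ _≡_ g → ∀ C → Σ ℕ (SparseFrom D P g C)
      sparse-from g g-inj C = suc (N g g-inj C) , no-dense g g-inj C

-- The patterns forced by large positive co-degree

injective? : ∀ {k m} (σ : Vec (Fin m) k) → Dec (∀ i j → lookup σ i ≡ lookup σ j → i ≡ j)
injective? σ = 𝔽.all? λ i → 𝔽.all? λ j → (lookup σ i ≟ᶠ lookup σ j) →-dec (i ≟ᶠ j)

relabel : ∀ {k m} → Pattern k → Vec (Fin m) k → Pattern m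
relabel P σ = map (mapTriple (lookup σ)) P

images-sparse : ∀ {D k} (hs : List (Vec (Fin k) 7)) → All FibresOfSize≤2 hs → All (Sparse D) (map image hs)
images-sparse []       []       = []
images-sparse (h ∷ hs) (p ∷ ps) = image-sparse h p ∷ images-sparse hs ps

relabels-sparse : ∀ {D k m} (P : Pattern k) (σs : List (Vec (Fin m) k)) →
  All (λ σ → ∀ i j → lookup σ i ≡ lookup σ j → i ≡ j) σs → Sparse D P → All (Sparse D) (map (relabel P) σs)
relabels-sparse P []       []       s = []
relabels-sparse P (σ ∷ σs) (i ∷ is) s = sparse-map P (lookup σ) (i _ _) s ∷ relabels-sparse P σs is s

-- All six triples through vertex 1: its link is the complete graph on `{0, 2, 3, 4}`.
star : Pattern 5
star = (# 1 , # 2 , # 3) ∷ (# 1 , # 2 , # 4) ∷ (# 1 , # 3 , # 4) ∷ (# 0 , # 1 , # 2) ∷ (# 0 , # 1 , # 3) ∷ (# 0 , # 1 , # 4) ∷ []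

star-weighting : Weighting 5
star-weighting = (1 , # 0 , # 2 , # 1) ∷ []

-- The new vertex is 0 and the old labels are raised by one. The centre serves as both `e` and `f`,
-- its four neighbours as `a`, `b`, `c`, `d`, and the new vertex as `g` on the pair `cd`. One
-- weighted pair is therefore enough.
star-maps : List (Vec (Fin 6) 7)
star-maps = (# 4 ∷ # 5 ∷ # 1 ∷ # 3 ∷ # 2 ∷ # 2 ∷ # 0 ∷ []) ∷ []

star-sparse : ∀ {D} → Sparse D star
star-sparse = sparse-extend star star-weighting (map image star-maps) refl 0 refl refl refl
  (images-sparse star-maps (from-yes (All.all? fibresOfSize≤2? star-maps)))

K₄⁻ : Pattern 4
K₄⁻ = (# 0 , # 1 , # 2) ∷ (# 0 , # 1 , # 3) ∷ (# 0 , # 2 , # 3) ∷ []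

-- `K₄⁻` on `{1, 2, 3, 4}` with apex 1; the link of 0 contains the path 1, 2, 3, 4, which starts at
-- the apex.
K₄⁻+path : Pattern 5
K₄⁻+path = (# 1 , # 2 , # 3) ∷ (# 1 , # 2 , # 4) ∷ (# 1 , # 3 , # 4) ∷ (# 0 , # 1 , # 2) ∷ (# 0 , # 2 , # 3) ∷ (# 0 , # 3 , # 4) ∷ []

-- An optimal solution of the linear program which minimises the largest weight of a link
-- that completes no image of F₁; the optimum is exactly 2/5 of the total weight.
K₄⁻+path-weighting : Weighting 5
K₄⁻+path-weighting =
    (4 , # 1 , # 2 , # 3)
  ∷ (3 , # 1 , # 3 , # 2)
  ∷ (3 , # 1 , # 4 , # 2)
  ∷ (1 , # 0 , # 1 , # 2)
  ∷ (3 , # 2 , # 3 , # 1)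
  ∷ (2 , # 2 , # 4 , # 1)
  ∷ (2 , # 0 , # 2 , # 1)
  ∷ (3 , # 3 , # 4 , # 1)
  ∷ (3 , # 0 , # 3 , # 2)
  ∷ (1 , # 0 , # 4 , # 3)
  ∷ []

-- Found by computer search, as a family whose links meet every link of weight above 10;
-- the vertex 0 is the new one, and the vertices of K₄⁻+path are shifted by one.
K₄⁻+path-maps : List (Vec (Fin 6) 7)
K₄⁻+path-maps =
    (# 3 ∷ # 5 ∷ # 4 ∷ # 1 ∷ # 2 ∷ # 0 ∷ # 3 ∷ [])
  ∷ (# 2 ∷ # 1 ∷ # 4 ∷ # 5 ∷ # 3 ∷ # 0 ∷ # 2 ∷ [])
  ∷ (# 3 ∷ # 0 ∷ # 4 ∷ # 5 ∷ # 2 ∷ # 2 ∷ # 1 ∷ [])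
  ∷ (# 2 ∷ # 4 ∷ # 1 ∷ # 0 ∷ # 3 ∷ # 3 ∷ # 4 ∷ [])
  ∷ (# 3 ∷ # 4 ∷ # 5 ∷ # 0 ∷ # 2 ∷ # 2 ∷ # 4 ∷ [])
  ∷ (# 3 ∷ # 5 ∷ # 4 ∷ # 0 ∷ # 2 ∷ # 2 ∷ # 5 ∷ [])
  ∷ (# 2 ∷ # 4 ∷ # 1 ∷ # 0 ∷ # 3 ∷ # 3 ∷ # 2 ∷ [])
  ∷ (# 2 ∷ # 0 ∷ # 5 ∷ # 1 ∷ # 3 ∷ # 3 ∷ # 4 ∷ [])
  ∷ (# 4 ∷ # 5 ∷ # 3 ∷ # 0 ∷ # 2 ∷ # 1 ∷ # 2 ∷ [])
  ∷ (# 4 ∷ # 1 ∷ # 2 ∷ # 0 ∷ # 3 ∷ # 3 ∷ # 4 ∷ [])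
  ∷ (# 5 ∷ # 0 ∷ # 2 ∷ # 1 ∷ # 4 ∷ # 4 ∷ # 3 ∷ [])
  ∷ (# 3 ∷ # 4 ∷ # 5 ∷ # 0 ∷ # 2 ∷ # 1 ∷ # 2 ∷ [])
  ∷ (# 4 ∷ # 5 ∷ # 3 ∷ # 0 ∷ # 2 ∷ # 2 ∷ # 5 ∷ [])
  ∷ (# 4 ∷ # 1 ∷ # 2 ∷ # 0 ∷ # 3 ∷ # 5 ∷ # 1 ∷ [])
  ∷ (# 3 ∷ # 0 ∷ # 4 ∷ # 1 ∷ # 2 ∷ # 2 ∷ # 3 ∷ [])
  ∷ (# 3 ∷ # 5 ∷ # 4 ∷ # 0 ∷ # 2 ∷ # 2 ∷ # 3 ∷ [])
  ∷ (# 3 ∷ # 0 ∷ # 2 ∷ # 1 ∷ # 4 ∷ # 4 ∷ # 3 ∷ [])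
  ∷ (# 2 ∷ # 0 ∷ # 3 ∷ # 4 ∷ # 5 ∷ # 5 ∷ # 2 ∷ [])
  ∷ (# 4 ∷ # 1 ∷ # 2 ∷ # 0 ∷ # 3 ∷ # 3 ∷ # 1 ∷ [])
  ∷ (# 1 ∷ # 0 ∷ # 3 ∷ # 5 ∷ # 4 ∷ # 4 ∷ # 2 ∷ [])
  ∷ (# 2 ∷ # 3 ∷ # 0 ∷ # 4 ∷ # 4 ∷ # 0 ∷ # 2 ∷ [])
  ∷ (# 3 ∷ # 5 ∷ # 4 ∷ # 0 ∷ # 2 ∷ # 2 ∷ # 1 ∷ [])
  ∷ (# 2 ∷ # 1 ∷ # 4 ∷ # 0 ∷ # 3 ∷ # 3 ∷ # 5 ∷ [])
  ∷ (# 2 ∷ # 4 ∷ # 1 ∷ # 5 ∷ # 3 ∷ # 0 ∷ # 4 ∷ [])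
  ∷ (# 3 ∷ # 0 ∷ # 2 ∷ # 4 ∷ # 1 ∷ # 1 ∷ # 3 ∷ [])
  ∷ (# 3 ∷ # 4 ∷ # 5 ∷ # 0 ∷ # 2 ∷ # 2 ∷ # 3 ∷ [])
  ∷ (# 2 ∷ # 1 ∷ # 4 ∷ # 0 ∷ # 3 ∷ # 3 ∷ # 2 ∷ [])
  ∷ (# 2 ∷ # 0 ∷ # 4 ∷ # 5 ∷ # 3 ∷ # 3 ∷ # 2 ∷ [])
  ∷ (# 2 ∷ # 4 ∷ # 1 ∷ # 0 ∷ # 3 ∷ # 3 ∷ # 5 ∷ [])
  ∷ (# 2 ∷ # 0 ∷ # 3 ∷ # 5 ∷ # 4 ∷ # 4 ∷ # 2 ∷ [])
  ∷ (# 4 ∷ # 1 ∷ # 2 ∷ # 0 ∷ # 3 ∷ # 3 ∷ # 5 ∷ [])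
  ∷ (# 1 ∷ # 0 ∷ # 3 ∷ # 5 ∷ # 2 ∷ # 4 ∷ # 2 ∷ [])
  ∷ (# 5 ∷ # 0 ∷ # 2 ∷ # 1 ∷ # 3 ∷ # 4 ∷ # 3 ∷ [])
  ∷ (# 2 ∷ # 0 ∷ # 5 ∷ # 3 ∷ # 4 ∷ # 1 ∷ # 2 ∷ [])
  ∷ (# 3 ∷ # 0 ∷ # 1 ∷ # 2 ∷ # 4 ∷ # 5 ∷ # 3 ∷ [])
  ∷ []

K₄⁻+path-sparse : ∀ {D} → Sparse D K₄⁻+path
-- The total weight is 25, so the bound 10 meets `5B ≤ 2W` with equality.
K₄⁻+path-sparse = sparse-extend K₄⁻+path K₄⁻+path-weighting (map image K₄⁻+path-maps) refl 10 refl refl refl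
  (images-sparse K₄⁻+path-maps (from-yes (All.all? fibresOfSize≤2? K₄⁻+path-maps)))

-- Pairs at the apex weigh 3 and the others 2, in all 15, of which `2/5` is 6. A link above 6
-- contains all three apex pairs, which gives `star`, or two apex pairs and a base pair, or one apex
-- pair and two base pairs.
K₄⁻-weighting : Weighting 4
K₄⁻-weighting =
    (3 , # 0 , # 1 , # 2)
  ∷ (3 , # 0 , # 2 , # 1)
  ∷ (3 , # 0 , # 3 , # 1)
  ∷ (2 , # 1 , # 2 , # 0)
  ∷ (2 , # 1 , # 3 , # 0)
  ∷ (2 , # 2 , # 3 , # 0)
  ∷ []

K₄⁻-maps : List (Vec (Fin 5) 7)
K₄⁻-maps =
    (# 1 ∷ # 2 ∷ # 0 ∷ # 3 ∷ # 3 ∷ # 0 ∷ # 1 ∷ [])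
  ∷ (# 2 ∷ # 3 ∷ # 4 ∷ # 0 ∷ # 1 ∷ # 1 ∷ # 2 ∷ [])
  ∷ (# 2 ∷ # 3 ∷ # 4 ∷ # 0 ∷ # 1 ∷ # 1 ∷ # 3 ∷ [])
  ∷ (# 2 ∷ # 4 ∷ # 3 ∷ # 0 ∷ # 1 ∷ # 1 ∷ # 2 ∷ [])
  ∷ (# 1 ∷ # 2 ∷ # 0 ∷ # 4 ∷ # 4 ∷ # 0 ∷ # 1 ∷ [])
  ∷ (# 2 ∷ # 4 ∷ # 3 ∷ # 0 ∷ # 1 ∷ # 1 ∷ # 4 ∷ [])
  ∷ (# 1 ∷ # 0 ∷ # 3 ∷ # 4 ∷ # 2 ∷ # 2 ∷ # 1 ∷ [])
  ∷ (# 3 ∷ # 4 ∷ # 2 ∷ # 0 ∷ # 1 ∷ # 1 ∷ # 3 ∷ [])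
  ∷ (# 3 ∷ # 4 ∷ # 2 ∷ # 0 ∷ # 1 ∷ # 1 ∷ # 4 ∷ [])
  ∷ (# 1 ∷ # 3 ∷ # 0 ∷ # 4 ∷ # 4 ∷ # 0 ∷ # 1 ∷ [])
  ∷ (# 1 ∷ # 0 ∷ # 2 ∷ # 4 ∷ # 3 ∷ # 3 ∷ # 1 ∷ [])
  ∷ (# 1 ∷ # 0 ∷ # 2 ∷ # 3 ∷ # 4 ∷ # 4 ∷ # 1 ∷ [])
  ∷ []

-- The new vertex 0 and the apex 1 stay fixed; the path may run through the three base vertices in
-- any order.
K₄⁻-paths : List (Vec (Fin 5) 5)
K₄⁻-paths =
    (# 0 ∷ # 1 ∷ # 2 ∷ # 3 ∷ # 4 ∷ [])
  ∷ (# 0 ∷ # 1 ∷ # 2 ∷ # 4 ∷ # 3 ∷ [])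
  ∷ (# 0 ∷ # 1 ∷ # 3 ∷ # 2 ∷ # 4 ∷ [])
  ∷ (# 0 ∷ # 1 ∷ # 3 ∷ # 4 ∷ # 2 ∷ [])
  ∷ (# 0 ∷ # 1 ∷ # 4 ∷ # 2 ∷ # 3 ∷ [])
  ∷ (# 0 ∷ # 1 ∷ # 4 ∷ # 3 ∷ # 2 ∷ [])
  ∷ []

K₄⁻-outcomes : List (Pattern 5)
K₄⁻-outcomes = star ∷ map (relabel K₄⁻+path) K₄⁻-paths ++ map image K₄⁻-maps

K₄⁻-sparse : ∀ {D} → Sparse D K₄⁻
K₄⁻-sparse = sparse-extend K₄⁻ K₄⁻-weighting K₄⁻-outcomes refl 6 refl refl refl
  (star-sparse ∷ All.++⁺
    (relabels-sparse K₄⁻+path K₄⁻-paths (from-yes (All.all? injective? K₄⁻-paths)) K₄⁻+path-sparse)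
    (images-sparse K₄⁻-maps (from-yes (All.all? fibresOfSize≤2? K₄⁻-maps))))

triangle : Pattern 3
triangle = (# 0 , # 1 , # 2) ∷ []

triangle-weighting : Weighting 3
triangle-weighting = (1 , # 0 , # 1 , # 2) ∷ (1 , # 0 , # 2 , # 1) ∷ (1 , # 1 , # 2 , # 0) ∷ []

-- A link with more than one of the three pairs contains two, and their common vertex is the apex of
-- a `K₄⁻`, listed first here. The new vertex 0 lies in its base.
triangle-apexes : List (Vec (Fin 4) 4)
triangle-apexes =
    (# 1 ∷ # 0 ∷ # 2 ∷ # 3 ∷ [])
  ∷ (# 2 ∷ # 0 ∷ # 1 ∷ # 3 ∷ [])
  ∷ (# 3 ∷ # 0 ∷ # 1 ∷ # 2 ∷ [])
  ∷ []

triangle-sparse : ∀ {D} → Sparse D triangle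
triangle-sparse = sparse-extend triangle triangle-weighting (map (relabel K₄⁻) triangle-apexes) refl 1 refl refl refl
  (relabels-sparse K₄⁻ triangle-apexes (from-yes (All.all? injective? triangle-apexes)) K₄⁻-sparse)

-- From the covered pair `xy` there are at least `κ` choices of `a` with `xya` an edge, then `κ` of
-- `b` with `axb` an edge, then `κ` of `c` with `abc` an edge, since each pair used is covered
-- again. Finally `n³ ≤ 125 κ³`.
triangles-dense : ∀ {n} (H : 3Graph n) κ → (∀ x y → InSomeEdge H x y → κ ≤ codeg H x y) → n ≤ 5 * κ →
  ∀ x y → InSomeEdge H x y → Dense n 3 125 (λ v → realises H (lookup v) triangle)
triangles-dense {n} H κ min n≤5κ x y xy = begin
  n ^ 3                        ≤⟨ ℕ.^-monoˡ-≤ 3 n≤5κ ⟩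
  (5 * κ) ^ 3                  ≡⟨ e κ ⟩
  125 * (κ * (κ * κ))          ≤⟨ ℕ.*-monoʳ-≤ 125 count ⟩
  125 * ∑ U (λ a → ∑ U (λ b → ∑ U (λ c → ⟦ edge H a b c ⟧)))
    ≡⟨ cong (125 *_) (sym flatten) ⟩
  125 * ∑ (vecs n 3) (λ v → ⟦ realises H (lookup v) triangle ⟧) ∎
  where
  open ℕ.≤-Reasoning
  U : List (Fin n)
  U = allFin n
  e : ∀ κ → 5 * κ * (5 * κ * (5 * κ * 1)) ≡ 125 * (κ * (κ * κ))
  e = solve-∀
  flatten : ∑ (vecs n 3) (λ v → ⟦ realises H (lookup v) triangle ⟧) ≡
            ∑ U (λ a → ∑ U (λ b → ∑ U (λ c → ⟦ edge H a b c ⟧)))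
  flatten = trans (∑-vecs n 2 _) (∑-cong U λ a → trans (∑-vecs n 1 _) (∑-cong U λ b →
    trans (∑-vecs n 0 _) (∑-cong U λ c → trans (ℕ.+-identityʳ _) (cong ⟦_⟧ (𝔹.∧-identityʳ (edge H a b c))))))
  along : (p : Fin n → Bool) (m : ℕ) (s : Fin n → ℕ) → κ ≤ ∑ U (λ z → ⟦ p z ⟧) →
    (∀ z → p z ≡ true → m ≤ s z) → κ * m ≤ ∑ U s
  along p m s many each = begin
    κ * m                         ≤⟨ ℕ.*-monoˡ-≤ m many ⟩
    ∑ U (λ z → ⟦ p z ⟧) * m       ≡⟨ ∑-*ʳ U _ m ⟨
    ∑ U (λ z → ⟦ p z ⟧ * m)       ≤⟨ ∑-mono U termwise ⟩
    ∑ U s                         ∎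
    where
    termwise : ∀ z → ⟦ p z ⟧ * m ≤ s z
    termwise z with p z in eq
    ... | false = z≤n
    ... | true  = ℕ.≤-trans (ℕ.≤-reflexive (ℕ.+-identityʳ m)) (each z eq)
  count : κ * (κ * κ) ≤ ∑ U (λ a → ∑ U (λ b → ∑ U (λ c → ⟦ edge H a b c ⟧)))
  count = along (edge H x y) (κ * κ) _ (min x y xy) λ a xya →
    let axy = trans (sym₁₂ H a x y) (trans (sym₂₃ H x a y) xya) in
    along (edge H a x) κ _ (min a x (edge⇒InSomeEdge H axy)) λ b axb →
    min a b (edge⇒InSomeEdge H (trans (sym₂₃ H a b x) axb))

-- Otherwise `H` is heavy. If it is edgeless, then `κ` is 0 and `n` would be 0; if not, its edges
-- have density `1/125`, which `triangle-sparse` excludes for large `n`.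
F₁-codegree-bound : ∀ D → 1 ≤ D → Σ ℕ λ N → ∀ n → 1 ≤ n → N ≤ n →
  (H : 3Graph n) → FFree F₁ H → ∀ κ → MinPosCodeg H κ → 5 * D * κ ℕ.< 2 * D * n + n
F₁-codegree-bound D 1≤D = N , bound
  where
  from-triangle : Σ ℕ (SparseFrom D triangle id 125)
  from-triangle = sparseFrom (triangle-sparse {D}) id id 125
  N : ℕ
  N = proj₁ from-triangle
  instance
    D≢0 : NonZero D
    D≢0 = ℕ.>-nonZero 1≤D
  bound : ∀ n → 1 ≤ n → N ≤ n → (H : 3Graph n) → FFree F₁ H → ∀ κ → MinPosCodeg H κ →
    5 * D * κ ℕ.< 2 * D * n + n
  bound n 1≤n N≤n H free κ (min , attained) = ℕ.≰⇒> λ heavy → impossible heavy attained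
    where
    open ℕ.≤-Reasoning
    impossible : 2 * D * n + n ≤ 5 * D * κ →
      ¬ ((Σ (Fin n) λ x → Σ (Fin n) λ y → InSomeEdge H x y × codeg H x y ≡ κ)
         ⊎ ((∀ (x y z : Fin n) → edge H x y z ≡ false) × κ ≡ 0))
    impossible heavy (inj₂ (_ , refl)) = ℕ.<⇒≱ 1≤n (begin
      n                 ≤⟨ ℕ.m≤n+m n (2 * D * n) ⟩
      2 * D * n + n     ≤⟨ heavy ⟩
      5 * D * 0         ≡⟨ ℕ.*-zeroʳ (5 * D) ⟩
      0                 ∎)
    impossible heavy (inj₁ (x , y , xy , _)) =
      proj₂ from-triangle n N≤n H κ free (min , heavy) _ (λ v r → r)
        (triangles-dense H κ min n≤5κ x y xy)
      where
      e₁ : ∀ D n → D * n + (D * n + n) ≡ 2 * D * n + n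
      e₁ = solve-∀
      e₂ : ∀ D κ → 5 * D * κ ≡ D * (5 * κ)
      e₂ = solve-∀
      n≤5κ : n ≤ 5 * κ
      n≤5κ = ℕ.*-cancelˡ-≤ D (begin
        D * n                    ≤⟨ ℕ.m≤m+n (D * n) (D * n + n) ⟩
        D * n + (D * n + n)      ≡⟨ e₁ D n ⟩
        2 * D * n + n            ≤⟨ heavy ⟩
        5 * D * κ                ≡⟨ e₂ D κ ⟩
        D * (5 * κ)              ∎)

-- The maximum is attained

Searchable : Set → Set₁
Searchable A = (P : A → Set) → (∀ a → Dec (P a)) → Dec (Σ A P)

search-Bool : Searchable Bool
search-Bool P P? with P? false | P? true
... | yes p | _     = yes (false , p)
... | no  _ | yes p = yes (true , p)
... | no ¬p | no ¬q = no λ { (false , p) → ¬p p ; (true , q) → ¬q q }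

search-Vec : {A : Set} → Searchable A → ∀ k → Searchable (Vec A k)
search-Vec search zero    P P? = map′ (λ p → [] , p) (λ { ([] , p) → p }) (P? [])
search-Vec search (suc k) P P? = map′ (λ { (x , v , p) → x ∷ v , p }) (λ { (x ∷ v , p) → x , v , p })
  (search _ λ x → search-Vec search k _ λ v → P? (x ∷ v))

_≈_ : ∀ {n} → 3Graph n → 3Graph n → Set
H ≈ H′ = ∀ x y z → edge H x y z ≡ edge H′ x y z

contains-cong : ∀ {n} {H H′ : 3Graph n} F → H ≈ H′ → Contains H F → Contains H′ F
contains-cong F H≈H′ (φ , φ-inj , φ-edges) =
  φ , φ-inj , All.map (λ { {a , b , c} e → trans (sym (H≈H′ (φ a) (φ b) (φ c))) e }) φ-edges

codeg-cong : ∀ {n} {H H′ : 3Graph n} → H ≈ H′ → ∀ x y → codeg H x y ≡ codeg H′ x y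
codeg-cong {n} H≈H′ x y = ∑-cong (allFin n) (λ z → cong ⟦_⟧ (H≈H′ x y z))

minPosCodeg-cong : ∀ {n} {H H′ : 3Graph n} → H ≈ H′ → ∀ {k} → MinPosCodeg H k → MinPosCodeg H′ k
minPosCodeg-cong {H = H} {H′} H≈H′ {k} (min , attained) =
  (λ x y xy → subst (k ≤_) (d x y) (min x y (subst (1 ≤_) (sym (d x y)) xy))) , attained′ attained
  where
  d : ∀ x y → codeg H x y ≡ codeg H′ x y
  d = codeg-cong {H = H} {H′} H≈H′
  attained′ : _ → _
  attained′ (inj₁ (x , y , xy , eq)) = inj₁ (x , y , subst (1 ≤_) (d x y) xy , trans (sym (d x y)) eq)
  attained′ (inj₂ (none , k≡0)) = inj₂ ((λ x y z → trans (sym (H≈H′ x y z)) (none x y z)) , k≡0)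

contains? : ∀ {n} (H : 3Graph n) F → Dec (Contains H F)
contains? {n} H F = map′
  (λ { (v , inj , es) → lookup v , (λ {i} {j} → inj i j) , es })
  (λ { (φ , inj , es) → Vec.tabulate φ ,
       (λ i j eq → inj (trans (sym (lookup∘tabulate φ i)) (trans eq (lookup∘tabulate φ j)))) ,
       All.map (λ { {a , b , c} e → subst (_≡ true) (sym (cong₃ (lookup∘tabulate φ a) (lookup∘tabulate φ b) (lookup∘tabulate φ c))) e }) es })
  (search-Vec (λ _ → 𝔽.any?) (size F) _ λ v →
    (𝔽.all? λ i → 𝔽.all? λ j → (lookup v i ≟ᶠ lookup v j) →-dec (i ≟ᶠ j)) ×-dec
    All.all? (λ { (a , b , c) → edge H (lookup v a) (lookup v b) (lookup v c) 𝔹.≟ true }) (edges F))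
  where
  cong₃ : ∀ {x x′ y y′ z z′} → x ≡ x′ → y ≡ y′ → z ≡ z′ → edge H x y z ≡ edge H x′ y′ z′
  cong₃ refl refl refl = refl

minPosCodeg? : ∀ {n} (H : 3Graph n) k → Dec (MinPosCodeg H k)
minPosCodeg? H k =
  (𝔽.all? λ x → 𝔽.all? λ y → (1 ℕ.≤? codeg H x y) →-dec (k ℕ.≤? codeg H x y)) ×-dec
  ((𝔽.any? λ x → 𝔽.any? λ y → (1 ℕ.≤? codeg H x y) ×-dec (codeg H x y ℕ.≟ k)) ⊎-dec
   ((𝔽.all? λ x → 𝔽.all? λ y → 𝔽.all? λ z → edge H x y z 𝔹.≟ false) ×-dec (k ℕ.≟ 0)))

-- The edge relation of a 3-graph is a function, whereas tables of Booleans can be enumerated. Every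
-- 3-graph agrees pointwise with one given by a table, and the properties in question respect this
-- agreement.
Table : ℕ → Set
Table n = Vec (Vec (Vec Bool n) n) n

entry : ∀ {n} → Table n → Fin n → Fin n → Fin n → Bool
entry t x y z = lookup (lookup (lookup t x) y) z

IsGraph : ∀ {n} → (Fin n → Fin n → Fin n → Bool) → Set
IsGraph e = (∀ x y z → e x y z ≡ e y x z) × (∀ x y z → e x y z ≡ e x z y) ×
  (∀ x y z → e x y z ≡ true → (x ≢ y) × (y ≢ z) × (x ≢ z))

isGraph? : ∀ {n} (e : Fin n → Fin n → Fin n → Bool) → Dec (IsGraph e)
isGraph? e =
  (𝔽.all? λ x → 𝔽.all? λ y → 𝔽.all? λ z → e x y z 𝔹.≟ e y x z) ×-dec
  (𝔽.all? λ x → 𝔽.all? λ y → 𝔽.all? λ z → e x y z 𝔹.≟ e x z y) ×-dec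
  (𝔽.all? λ x → 𝔽.all? λ y → 𝔽.all? λ z → (e x y z 𝔹.≟ true) →-dec
    (¬? (x ≟ᶠ y) ×-dec ¬? (y ≟ᶠ z) ×-dec ¬? (x ≟ᶠ z)))

fromTable : ∀ {n} (t : Table n) → IsGraph (entry t) → 3Graph n
fromTable t (s₁₂ , s₂₃ , d) = record { edge = entry t ; sym₁₂ = s₁₂ ; sym₂₃ = s₂₃ ; distinct = d }

module _ {n : ℕ} (H : 3Graph n) where

  toTable : Table n
  toTable = Vec.tabulate λ x → Vec.tabulate λ y → Vec.tabulate λ z → edge H x y z

  entry-toTable : ∀ x y z → entry toTable x y z ≡ edge H x y z
  entry-toTable x y z = trans
    (cong (λ r → lookup (lookup r y) z) (lookup∘tabulate _ x)) (trans
    (cong (λ r → lookup r z) (lookup∘tabulate _ y)) (lookup∘tabulate _ z))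

  toTable-isGraph : IsGraph (entry toTable)
  toTable-isGraph =
    (λ x y z → trans (entry-toTable x y z) (trans (sym₁₂ H x y z) (sym (entry-toTable y x z)))) ,
    (λ x y z → trans (entry-toTable x y z) (trans (sym₂₃ H x y z) (sym (entry-toTable x z y)))) ,
    (λ x y z eq → distinct H x y z (trans (sym (entry-toTable x y z)) eq))

Attains : ℕ → Small3Graph → ℕ → Set
Attains n F k = Σ (3Graph n) λ H → FFree F H × MinPosCodeg H k

attains? : ∀ n F k → Dec (Attains n F k)
attains? n F k = map′
  (λ { (t , g , p) → fromTable t g , p })
  (λ { (H , free , min) → toTable H , toTable-isGraph H ,
       (λ c → free (contains-cong {H = fromTable (toTable H) (toTable-isGraph H)} {H} F (entry-toTable H) c)) ,
       minPosCodeg-cong {H = H} {fromTable (toTable H) (toTable-isGraph H)} (λ x y z → sym (entry-toTable H x y z)) min })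
  (search-Vec (search-Vec (search-Vec search-Bool n) n) n _ search-graph)
  where
  search-graph : ∀ t → Dec (Σ (IsGraph (entry t)) λ g → FFree F (fromTable t g) × MinPosCodeg (fromTable t g) k)
  search-graph t with isGraph? (entry t)
  ... | no ¬g = no (λ (g , _) → ¬g g)
  ... | yes g = map′ (g ,_) proj₂
        (¬? (contains? (fromTable t g) F) ×-dec minPosCodeg? (fromTable t g) k)

attains-bound : ∀ {n F k} → Attains n F k → k ≤ n
attains-bound {n} (H , _ , _ , inj₁ (x , y , _ , refl)) =
  ℕ.≤-trans (∑⟦⟧≤length (allFin n) (edge H x y)) (ℕ.≤-reflexive (length-allFin n))
attains-bound (H , _ , _ , inj₂ (_ , refl)) = z≤n

-- Search downwards from the bound; the given `a` guarantees a hit at 0 at the latest.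
greatest : (P : ℕ → Set) → (∀ k → Dec (P k)) → ∀ b → (∀ k → P k → k ≤ b) → ∀ {a} → P a →
  Σ ℕ λ m → P m × (∀ k → P k → k ≤ m)
greatest P P? b bound {a} Pa with P? b
... | yes Pb = b , Pb , bound
greatest P P? zero    bound {a} Pa | no ¬Pb = contradiction (subst P (ℕ.n≤0⇒n≡0 (bound a Pa)) Pa) ¬Pb
greatest P P? (suc b) bound {a} Pa | no ¬Pb = greatest P P? b
  (λ k Pk → ℕ.s≤s⁻¹ (ℕ.≤∧≢⇒< (bound k Pk) (λ { refl → ¬Pb Pk }))) Pa

coPlusEx-exists : ∀ n F {a} → Attains n F a → Σ ℕ λ m → IsCoPlusEx n F m × a ≤ m
coPlusEx-exists n F {a} attained =
  let m , best , max = greatest (Attains n F) (attains? n F) n (λ _ → attains-bound) attained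
  in m , (best , λ H free k min → max k (H , free , min)) , max a attained

-- The extremal construction

∑-allFin-suc : ∀ n (f : Fin (suc n) → ℕ) → ∑ (allFin (suc n)) f ≡ f zero + ∑ (allFin n) (f ∘ suc)
∑-allFin-suc n f = cong (λ s → f zero + sum s)
  (trans (map-tabulate suc f) (sym (map-tabulate id (f ∘ suc))))

∑-allFin-+ : ∀ m n (f : Fin (m + n) → ℕ) →
  ∑ (allFin (m + n)) f ≡ ∑ (allFin m) (λ i → f (i 𝔽.↑ˡ n)) + ∑ (allFin n) (λ j → f (m 𝔽.↑ʳ j))
∑-allFin-+ zero    n f = refl
∑-allFin-+ (suc m) n f = trans (∑-allFin-suc (m + n) f) (trans
  (cong (λ s → f zero + s) (∑-allFin-+ m n (f ∘ suc))) (trans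
  (sym (ℕ.+-assoc (f zero) _ _))
  (cong (_+ ∑ (allFin n) (λ j → f (suc (m 𝔽.↑ʳ j)))) (sym (∑-allFin-suc m (λ i → f (i 𝔽.↑ˡ n)))))))

Colour : Set
Colour = Fin 4

-- Colour 3 is the large class; `base` asks that the third argument lie in it, and the three
-- rotations cover its possible positions.
allowed : Colour → Colour → Colour → Bool
allowed i j k = base i j k ∨ base j k i ∨ base k i j
  where
  base : Colour → Colour → Colour → Bool
  base i j k = not (i == j) ∧ not (i == (# 3)) ∧ not (j == (# 3)) ∧ k == (# 3)

allowed-sym₁₂ : ∀ i j k → allowed i j k ≡ allowed j i k
allowed-sym₁₂ = from-yes (𝔽.all? λ i → 𝔽.all? λ j → 𝔽.all? λ k → allowed i j k 𝔹.≟ allowed j i k)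

allowed-sym₂₃ : ∀ i j k → allowed i j k ≡ allowed i k j
allowed-sym₂₃ = from-yes (𝔽.all? λ i → 𝔽.all? λ j → 𝔽.all? λ k → allowed i j k 𝔹.≟ allowed i k j)

allowed-distinct : ∀ i j k → allowed i j k ≡ true → (i ≢ j) × (j ≢ k) × (i ≢ k)
allowed-distinct = from-yes (𝔽.all? λ i → 𝔽.all? λ j → 𝔽.all? λ k → (allowed i j k 𝔹.≟ true) →-dec
  (¬? (i ≟ᶠ j) ×-dec ¬? (j ≟ᶠ k) ×-dec ¬? (i ≟ᶠ k)))

-- Decided by checking colours. Each hypothesis follows as soon as its colours are fixed, so that
-- most of the `4 ^ 7` colourings are cut off early.
allowed-F₁-free : ∀ a b e → allowed a b e ≡ true → ∀ c → allowed a c e ≡ true → allowed b c e ≡ true →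
  ∀ f → allowed a b f ≡ true → ∀ d → allowed a d f ≡ true → allowed b d f ≡ true →
  ∀ g → ¬ (allowed c d g ≡ true)
allowed-F₁-free = from-yes (
  𝔽.all? λ a → 𝔽.all? λ b → 𝔽.all? λ e → (allowed a b e 𝔹.≟ true) →-dec
  (𝔽.all? λ c → (allowed a c e 𝔹.≟ true) →-dec ((allowed b c e 𝔹.≟ true) →-dec
  (𝔽.all? λ f → (allowed a b f 𝔹.≟ true) →-dec
  (𝔽.all? λ d → (allowed a d f 𝔹.≟ true) →-dec ((allowed b d f 𝔹.≟ true) →-dec
  (𝔽.all? λ g → ¬? (allowed c d g 𝔹.≟ true))))))))

module _ (t r : ℕ) where

  colour : Fin (t + (t + (t + r))) → Colour
  colour x with 𝔽.splitAt t x
  ... | inj₁ _ = # 0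
  ... | inj₂ x′ with 𝔽.splitAt t x′
  ...   | inj₁ _ = # 1
  ...   | inj₂ x″ with 𝔽.splitAt t x″
  ...     | inj₁ _ = # 2
  ...     | inj₂ _ = # 3

  colour-0 : ∀ (i : Fin t) → colour (i 𝔽.↑ˡ (t + (t + r))) ≡ # 0
  colour-0 i rewrite 𝔽.splitAt-↑ˡ t i (t + (t + r)) = refl

  colour-1 : ∀ (i : Fin t) → colour (t 𝔽.↑ʳ (i 𝔽.↑ˡ (t + r))) ≡ # 1
  colour-1 i rewrite 𝔽.splitAt-↑ʳ t (t + (t + r)) (i 𝔽.↑ˡ (t + r)) | 𝔽.splitAt-↑ˡ t i (t + r) = refl

  colour-2 : ∀ (i : Fin t) → colour (t 𝔽.↑ʳ (t 𝔽.↑ʳ (i 𝔽.↑ˡ r))) ≡ # 2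
  colour-2 i rewrite 𝔽.splitAt-↑ʳ t (t + (t + r)) (t 𝔽.↑ʳ (i 𝔽.↑ˡ r))
    | 𝔽.splitAt-↑ʳ t (t + r) (i 𝔽.↑ˡ r) | 𝔽.splitAt-↑ˡ t i r = refl

  colour-3 : ∀ (i : Fin r) → colour (t 𝔽.↑ʳ (t 𝔽.↑ʳ (t 𝔽.↑ʳ i))) ≡ # 3
  colour-3 i rewrite 𝔽.splitAt-↑ʳ t (t + (t + r)) (t 𝔽.↑ʳ (t 𝔽.↑ʳ i))
    | 𝔽.splitAt-↑ʳ t (t + r) (t 𝔽.↑ʳ i) | 𝔽.splitAt-↑ʳ t r i = refl

  coloured : 3Graph (t + (t + (t + r)))
  coloured = record
    { edge     = λ x y z → allowed (colour x) (colour y) (colour z)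
    ; sym₁₂    = λ x y z → allowed-sym₁₂ (colour x) (colour y) (colour z)
    ; sym₂₃    = λ x y z → allowed-sym₂₃ (colour x) (colour y) (colour z)
    ; distinct = λ x y z xyz → let i≢j , j≢k , i≢k = allowed-distinct (colour x) (colour y) (colour z) xyz
                 in (i≢j ∘ cong colour) , (j≢k ∘ cong colour) , (i≢k ∘ cong colour)
    }

  coloured-F₁-free : FFree F₁ coloured
  coloured-F₁-free (φ , _ , abe ∷ ace ∷ bce ∷ abf ∷ adf ∷ bdf ∷ cdg ∷ []) =
    allowed-F₁-free (c (# 0)) (c (# 1)) (c (# 4)) abe (c (# 2)) ace bce (c (# 5)) abf
                    (c (# 3)) adf bdf (c (# 6)) cdg
    where
    c : Fin 7 → Colour
    c = colour ∘ φ

  colour-codeg : Colour → Colour → ℕ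
  colour-codeg i j = ⟦ allowed i j (# 0) ⟧ * t + (⟦ allowed i j (# 1) ⟧ * t +
    (⟦ allowed i j (# 2) ⟧ * t + ⟦ allowed i j (# 3) ⟧ * r))

  codeg-coloured : ∀ x y → codeg coloured x y ≡ colour-codeg (colour x) (colour y)
  codeg-coloured x y = trans (∑-allFin-+ t (t + (t + r)) _) (cong₂ _+_ (part t (# 0) colour-0)
    (trans (∑-allFin-+ t (t + r) _) (cong₂ _+_ (part t (# 1) colour-1)
    (trans (∑-allFin-+ t r _) (cong₂ _+_ (part t (# 2) colour-2) (part r (# 3) colour-3))))))
    where
    part : ∀ s k {ι : Fin s → Fin (t + (t + (t + r)))} → (∀ i → colour (ι i) ≡ k) →
      ∑ (allFin s) (λ i → ⟦ edge coloured x y (ι i) ⟧) ≡ ⟦ allowed (colour x) (colour y) k ⟧ * s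
    part s k {ι} eq = begin
      ∑ (allFin s) (λ i → ⟦ edge coloured x y (ι i) ⟧)
        ≡⟨ ∑-cong (allFin s) (λ i → cong (λ c → ⟦ allowed (colour x) (colour y) c ⟧) (eq i)) ⟩
      ∑ (allFin s) (λ _ → ⟦ allowed (colour x) (colour y) k ⟧)
        ≡⟨ trans (∑-const (allFin s) _) (cong (_* _) (length-allFin s)) ⟩
      s * ⟦ allowed (colour x) (colour y) k ⟧
        ≡⟨ ℕ.*-comm s _ ⟩
      ⟦ allowed (colour x) (colour y) k ⟧ * s ∎
      where open ≡-Reasoning

  module _ (2t≤r : 2 * t ≤ r) where

    private
      light : 2 * t ≤ r + 0
      light = ℕ.≤-trans 2t≤r (ℕ.m≤m+n r 0)
      e₀ : ∀ t → 2 * t ≡ 0 + (1 * t + (1 * t + 0))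
      e₀ = solve-∀
      e₁ : ∀ t → 2 * t ≡ 1 * t + (0 + (1 * t + 0))
      e₁ = solve-∀
      e₂ : ∀ t → 2 * t ≡ 1 * t + (1 * t + (0 + 0))
      e₂ = solve-∀

    -- Two small classes have co-degree `r ≥ 2t`; a small class and the large one have the two other
    -- small classes, exactly `2t`; a pair inside one class lies in no edge.
    colour-codeg-min : ∀ i j → 1 ≤ colour-codeg i j → 2 * t ≤ colour-codeg i j
    colour-codeg-min zero zero ()
    colour-codeg-min zero (suc zero) _ = light
    colour-codeg-min zero (suc (suc zero)) _ = light
    colour-codeg-min zero (suc (suc (suc zero))) _ = ℕ.≤-reflexive (e₀ t)
    colour-codeg-min (suc zero) zero _ = light
    colour-codeg-min (suc zero) (suc zero) ()
    colour-codeg-min (suc zero) (suc (suc zero)) _ = light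
    colour-codeg-min (suc zero) (suc (suc (suc zero))) _ = ℕ.≤-reflexive (e₁ t)
    colour-codeg-min (suc (suc zero)) zero _ = light
    colour-codeg-min (suc (suc zero)) (suc zero) _ = light
    colour-codeg-min (suc (suc zero)) (suc (suc zero)) ()
    colour-codeg-min (suc (suc zero)) (suc (suc (suc zero))) _ = ℕ.≤-reflexive (e₂ t)
    colour-codeg-min (suc (suc (suc zero))) zero _ = ℕ.≤-reflexive (e₀ t)
    colour-codeg-min (suc (suc (suc zero))) (suc zero) _ = ℕ.≤-reflexive (e₁ t)
    colour-codeg-min (suc (suc (suc zero))) (suc (suc zero)) _ = ℕ.≤-reflexive (e₂ t)
    colour-codeg-min (suc (suc (suc zero))) (suc (suc (suc zero))) ()

    coloured-minPosCodeg : 1 ≤ t → Fin t → Fin r → MinPosCodeg coloured (2 * t)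
    coloured-minPosCodeg 1≤t i j =
      (λ x y xy → subst (2 * t ≤_) (sym (codeg-coloured x y))
        (colour-codeg-min (colour x) (colour y) (subst (1 ≤_) (codeg-coloured x y) xy))) ,
      inj₁ (x₀ , y₀ , ℕ.≤-trans (ℕ.≤-trans 1≤t (ℕ.m≤m+n t (t + 0))) (ℕ.≤-reflexive (sym attained)) , attained)
      where
      x₀ y₀ : Fin (t + (t + (t + r)))
      x₀ = i 𝔽.↑ˡ (t + (t + r))
      y₀ = t 𝔽.↑ʳ (t 𝔽.↑ʳ (t 𝔽.↑ʳ j))
      attained : codeg coloured x₀ y₀ ≡ 2 * t
      attained = trans (codeg-coloured x₀ y₀) (trans (cong₂ colour-codeg (colour-0 i) (colour-3 j)) (sym (e₀ t)))

attains-2/5 : ∀ n → 5 ≤ n → Σ ℕ λ t → Attains n F₁ (2 * t) × n ℕ.< 5 * suc t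
attains-2/5 n 5≤n = t , subst (λ n → Attains n F₁ (2 * t)) n≡
  (coloured t r , coloured-F₁-free t r , coloured-minPosCodeg t r 2t≤r 1≤t (𝔽.fromℕ< 1≤t)
    (𝔽.fromℕ< (ℕ.≤-trans (ℕ.≤-trans 1≤t (ℕ.m≤m+n t (t + 0))) 2t≤r))) ,
  n<5+5t
  where
  t r : ℕ
  t = n ℕ./ 5
  r = n ℕ.∸ 3 * t
  1≤t : 1 ≤ t
  1≤t = ℕ./-monoˡ-≤ 5 5≤n
  n<5+5t : n ℕ.< 5 * suc t
  n<5+5t = begin-strict
    n                   ≡⟨ ℕ.m≡m%n+[m/n]*n n 5 ⟩
    n ℕ.% 5 + t * 5     <⟨ ℕ.+-monoˡ-< (t * 5) (ℕ.m%n<n n 5) ⟩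
    5 + t * 5           ≡⟨ ℕ.*-comm (suc t) 5 ⟩
    5 * suc t           ∎
    where open ℕ.≤-Reasoning
  5t≤n : 2 * t + 3 * t ≤ n
  5t≤n = ℕ.≤-trans (ℕ.≤-reflexive (e t)) (ℕ.m/n*n≤m n 5)
    where
    e : ∀ t → 2 * t + 3 * t ≡ t * 5
    e = solve-∀
  2t≤r : 2 * t ≤ r
  2t≤r = ℕ.m+n≤o⇒m≤o∸n (2 * t) 5t≤n
  n≡ : t + (t + (t + r)) ≡ n
  n≡ = trans (e t r) (ℕ.m+[n∸m]≡n (ℕ.m+n≤o⇒n≤o (2 * t) 5t≤n))
    where
    e : ∀ t r → t + (t + (t + r)) ≡ 3 * t + r
    e = solve-∀

-- Distance in ℚ

-- The distance is `|5m - 2n| / (5n)`, and the hypothesis puts it below `1/q`, where `q` is the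
-- denominator of `ε`. This is at most `ε`, whose numerator is at least 1.
fraction-distance : ∀ m n .{{_ : NonZero n}} (ε : ℚ) → Positive ε →
  ℤ.∣ m * 5 ℤ.⊖ 2 * n ∣ * ℚ.↧ₙ ε ℕ.< n * 5 → ∣ (+ m / n) - (+ 2 / 5) ∣ < ε
fraction-distance m n@(suc n-1) ε@(ℚ.mkℚ ℤ.+[1+ p ] q-1 _) _ close =
  ℚ.toℚᵘ-cancel-< (ℚᵘ.<-respˡ-≃ (ℚᵘ.≃-sym unnormalise) (ℚᵘ.*<* (begin-strict
    + ℤ.∣ + m ℤ.* + 5 ℤ.+ ℤ.-[1+ 1 ] ℤ.* + n ∣ ℤ.* + suc q-1
      ≡⟨ cong (λ i → + ℤ.∣ i ∣ ℤ.* + suc q-1) numerator ⟩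
    + ℤ.∣ m * 5 ℤ.⊖ 2 * n ∣ ℤ.* + suc q-1       ≡⟨ ℤ.pos-* ℤ.∣ m * 5 ℤ.⊖ 2 * n ∣ (suc q-1) ⟨
    + (ℤ.∣ m * 5 ℤ.⊖ 2 * n ∣ * suc q-1)         <⟨ ℤ.+<+ (ℕ.<-≤-trans close (ℕ.m≤m+n (n * 5) _)) ⟩
    + (suc p * (n * 5))                         ≡⟨ ℤ.pos-* (suc p) (n * 5) ⟩
    + suc p ℤ.* + (n * 5)                       ∎)))
  where
  open ℤ.≤-Reasoning
  numerator : + m ℤ.* + 5 ℤ.+ ℤ.-[1+ 1 ] ℤ.* + n ≡ m * 5 ℤ.⊖ 2 * n
  numerator = trans (cong (ℤ._+ ℤ.-[1+ 1 ] ℤ.* + n) (sym (ℤ.pos-* m 5))) (ℤ.m-n≡m⊖n (m * 5) (2 * n))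
  unnormalise : ℚ.toℚᵘ ∣ (+ m / n) - (+ 2 / 5) ∣ ℚᵘ.≃ ℚᵘ.∣ ℚᵘ.mkℚᵘ (+ m) n-1 ℚᵘ.- ℚᵘ.mkℚᵘ (+ 2) 4 ∣
  unnormalise = ℚᵘ.≃-trans (ℚ.toℚᵘ-homo-∣-∣ ((+ m / n) - (+ 2 / 5))) (ℚᵘ.∣-∣-cong
    (ℚᵘ.≃-trans (ℚ.toℚᵘ-homo-+ (+ m / n) (ℚ.- (+ 2 / 5)))
      (ℚᵘ.+-cong (ℚ.toℚᵘ-fromℚᵘ (ℚᵘ.mkℚᵘ (+ m) n-1)) (ℚ.toℚᵘ-homo‿- (+ 2 / 5)))))

∸-scaled : ∀ q x y b → x ≤ y → q * y ℕ.< q * x + b → (y ℕ.∸ x) * q ℕ.< b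
∸-scaled q x y b x≤y qy<qx+b = ℕ.+-cancelˡ-< (q * x) _ _ (begin-strict
  q * x + (y ℕ.∸ x) * q      ≡⟨ cong (λ d → q * x + d) (ℕ.*-comm (y ℕ.∸ x) q) ⟩
  q * x + q * (y ℕ.∸ x)      ≡⟨ ℕ.*-distribˡ-+ q x (y ℕ.∸ x) ⟨
  q * (x + (y ℕ.∸ x))        ≡⟨ cong (q *_) (ℕ.m+[n∸m]≡n x≤y) ⟩
  q * y                      <⟨ qy<qx+b ⟩
  q * x + b                  ∎)
  where open ℕ.≤-Reasoning

∣⊖∣-scaled : ∀ q x y b → q * x ℕ.< q * y + b → q * y ℕ.< q * x + b → ℤ.∣ x ℤ.⊖ y ∣ * q ℕ.< b
∣⊖∣-scaled q x y b above below with ℕ.≤-total x y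
... | inj₁ x≤y rewrite ℤ.∣⊖∣-≤ x≤y = ∸-scaled q x y b x≤y below
... | inj₂ y≤x rewrite ℤ.∣m⊖n∣≡∣n⊖m∣ x y | ℤ.∣⊖∣-≤ y≤x = ∸-scaled q y x b y≤x above

theorem2p3 : ∀ (ε : ℚ) → Positive ε →
    Σ ℕ λ N → ∀ (n : ℕ) .{{_ : NonZero n}} → N ≤ n →
      Σ ℕ λ m → IsCoPlusEx n F₁ m × (∣ (+ m / n) - (+ 2 / 5) ∣ < ε)
theorem2p3 ε ε>0 = N , limit
  where
  q : ℕ
  q = ℚ.↧ₙ ε
  upper : Σ ℕ λ N → ∀ n → 1 ≤ n → N ≤ n →
    (H : 3Graph n) → FFree F₁ H → ∀ κ → MinPosCodeg H κ → 5 * q * κ ℕ.< 2 * q * n + n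
  -- With `D = q` the excess over `2/5` is below `1/(5q)`, which is less than `ε`.
  upper = F₁-codegree-bound q (s≤s z≤n)
  N : ℕ
  -- The 5 makes the small classes nonempty, and `2 * q` absorbs the rounding in `⌊n/5⌋`.
  N = 5 + (2 * q + proj₁ upper)
  limit : ∀ (n : ℕ) .{{_ : NonZero n}} → N ≤ n →
    Σ ℕ λ m → IsCoPlusEx n F₁ m × (∣ (+ m / n) - (+ 2 / 5) ∣ < ε)
  limit n N≤n = m , isMax , fraction-distance m n ε ε>0 (∣⊖∣-scaled q (m * 5) (2 * n) (n * 5) above below)
    where
    open ℕ.≤-Reasoning
    5≤n : 5 ≤ n
    5≤n = ℕ.m+n≤o⇒m≤o 5 N≤n
    2q≤n : 2 * q ≤ n
    2q≤n = ℕ.m+n≤o⇒m≤o (2 * q) (ℕ.m+n≤o⇒n≤o 5 N≤n)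
    lower : Σ ℕ λ t → Attains n F₁ (2 * t) × n ℕ.< 5 * suc t
    lower = attains-2/5 n 5≤n
    t : ℕ
    t = proj₁ lower
    best : Σ ℕ λ m → IsCoPlusEx n F₁ m × 2 * t ≤ m
    best = coPlusEx-exists n F₁ (proj₁ (proj₂ lower))
    m : ℕ
    m = proj₁ best
    isMax : IsCoPlusEx n F₁ m
    isMax = proj₁ (proj₂ best)
    above : q * (m * 5) ℕ.< q * (2 * n) + n * 5
    above = begin-strict
      q * (m * 5)            ≡⟨ e₁ q m ⟩
      5 * q * m              <⟨ extremal (proj₁ isMax) ⟩
      2 * q * n + n          ≤⟨ ℕ.m≤m+n _ (4 * n) ⟩
      2 * q * n + n + 4 * n  ≡⟨ e₂ q n ⟩
      q * (2 * n) + n * 5    ∎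
      where
      e₁ : ∀ q m → q * (m * 5) ≡ 5 * q * m
      e₁ = solve-∀
      e₂ : ∀ q n → 2 * q * n + n + 4 * n ≡ q * (2 * n) + n * 5
      e₂ = solve-∀
      extremal : (Σ (3Graph n) λ H → FFree F₁ H × MinPosCodeg H m) → 5 * q * m ℕ.< 2 * q * n + n
      extremal (H , free , min) = proj₂ upper n (ℕ.≤-trans (s≤s z≤n) 5≤n)
        (ℕ.m+n≤o⇒n≤o (2 * q) (ℕ.m+n≤o⇒n≤o 5 N≤n)) H free m min
    -- Rounding down costs `2 * q * 5` here, which is at most `n * 5`.
    below : q * (2 * n) ℕ.< q * (m * 5) + n * 5
    below = begin-strict
      q * (2 * n)                        ≡⟨ e₁ q n ⟩
      2 * q * n                          <⟨ ℕ.*-monoʳ-< (2 * q) (proj₂ (proj₂ lower)) ⟩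
      2 * q * (5 * suc t)                ≡⟨ e₂ q t ⟩
      q * (2 * t * 5) + 2 * q * 5        ≤⟨ ℕ.+-mono-≤ (ℕ.*-monoʳ-≤ q (ℕ.*-monoˡ-≤ 5 (proj₂ (proj₂ best))))
                                              (ℕ.*-monoˡ-≤ 5 2q≤n) ⟩
      q * (m * 5) + n * 5                ∎
      where
      e₁ : ∀ q n → q * (2 * n) ≡ 2 * q * n
      e₁ = solve-∀
      e₂ : ∀ q t → 2 * q * (5 * suc t) ≡ q * (2 * t * 5) + 2 * q * 5
      e₂ = solve-∀
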